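{- Let $k \ge 4$ be an integer. If $G$ is a connected $k$-regular graph that is not isomorphic to the complete bipartite graph $K_{k,k}$, then $\frac{i(G)}{\gamma(G)} \le \frac{k^3-3k^2+2}{2k^2-6k+2}$.
   Context: All graphs are finite and simple. A dominating set of a graph $G$ is a set $S \subseteq V(G)$ such that every vertex not in $S$ has a neighbor in $S$. The domination number $\gamma(G)$ is the minimum size of a dominating set of $G$. An independent dominating set is a dominating set that is also an independent set, and the independent domination number $i(G)$ is the minimum size of an independent dominating set of $G$. -}

module Defs where

open import Data.Nat using (ℕ; _<?_; _+_; _≤_)
open import Data.Bool using (Bool; true; false; T; not; _xor_)
open import Data.Bool.Properties using (T?; xor-same)
open import Data.Fin using (Fin; toℕ)
open import Data.Fin.Subset using (Subset; _∈_; _∉_; ∣_∣)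
open import Data.Product using (Σ; ∃; _×_; _,_)
open import Data.List using (filter; length; allFin)
open import Relation.Binary.PropositionalEquality using (_≡_; refl)
open import Relation.Nullary using (¬_; yes; no)
open import Function.Bundles using (_↔_; Inverse)

record Graph (n : ℕ) : Set where
  field
    adj     : Fin n → Fin n → Bool
    adj-sym : ∀ u v → adj u v ≡ adj v u
    adj-irr : ∀ v → adj v v ≡ false
open Graph public

Adj : ∀ {n} → Graph n → Fin n → Fin n → Set
Adj G u v = T (adj G u v)

degree : ∀ {n} → Graph n → Fin n → ℕ
degree {n} G v = length (filter (λ u → T? (adj G v u)) (allFin n))

Regular : ∀ {n} → ℕ → Graph n → Set
Regular k G = ∀ v → degree G v ≡ k

data Reach {n} (G : Graph n) : Fin n → Fin n → Set where
  here : ∀ {v} → Reach G v v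
  step : ∀ {u w v} → Adj G u w → Reach G w v → Reach G u v

Connected : ∀ {n} → Graph n → Set
Connected G = ∀ u v → Reach G u v

Iso : ∀ {n m} → Graph n → Graph m → Set
Iso {n} {m} G H =
  Σ (Fin n ↔ Fin m) λ f →
    ∀ u v → adj G u v ≡ adj H (Inverse.to f u) (Inverse.to f v)

side : ∀ {m} → ℕ → Fin m → Bool
side k x with toℕ x <? k
... | yes _ = true
... | no _  = false

xor-comm' : ∀ a b → a xor b ≡ b xor a
xor-comm' false false = refl
xor-comm' false true  = refl
xor-comm' true  false = refl
xor-comm' true  true  = refl

K : (k : ℕ) → Graph (k + k)
K k = record
  { adj     = λ u v → side k u xor side k v
  ; adj-sym = λ u v → xor-comm' (side k u) (side k v)
  ; adj-irr = λ v → xor-same (side k v)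
  }

Dominating : ∀ {n} → Graph n → Subset n → Set
Dominating G S = ∀ v → v ∉ S → ∃ λ u → u ∈ S × Adj G v u

Independent : ∀ {n} → Graph n → Subset n → Set
Independent G S = ∀ u v → u ∈ S → v ∈ S → ¬ Adj G u v

IndependentDominating : ∀ {n} → Graph n → Subset n → Set
IndependentDominating G S = Independent G S × Dominating G S

IsMinSize : ∀ {n} → (Subset n → Set) → ℕ → Set
IsMinSize P d = (∃ λ S → P S × ∣ S ∣ ≡ d) × (∀ S → P S → d ≤ ∣ S ∣)

IsDominationNumber : ∀ {n} → Graph n → ℕ → Set
IsDominationNumber G = IsMinSize (Dominating G)

IsIndependentDominationNumber : ∀ {n} → Graph n → ℕ → Set
IsIndependentDominationNumber G = IsMinSize (IndependentDominating G)

{-# OPTIONS --safe #-}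
module Submission where

-- For a k-regular G ≠ K_{k,k} one has (2k - 1) i ≤ (k - 1) n.  Take a minimum independent
-- dominating set I, and let d(u) be the number of neighbours in I of a vertex u ∉ I.  Counting
-- edges, the bound says that the total slack Σ (k - 1 - d(u)) over u ∉ I is nonnegative.  Only the
-- full vertices, those with d(v) = k, have negative slack, and they are paid for by other vertices.
-- If W is independent and disjoint from I, then replacing the neighbours of W in I by W leaves
-- undominated only vertices whose I-neighbours are all neighbours of W; as I is minimum, there are
-- many of these.  For W = {v} this yields vertices u with N(u) ∩ I ⊆ N(v) and slack to spare, unless
-- v sits on a K_{k-1,k}.  Those cases are settled by choosing I, among the minimum sets, such that
-- as many vertices as possible have k - 1 twins (counting themselves) and d = k - 1.
--
-- If D is a minimum dominating set, with a isolated and b other vertices in G[D], then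
-- n ≤ (k + 1) a + k b, and extending a maximal independent subset of D that contains as many leaves
-- of G[D] as possible gives i ≤ a + (k - 2) b.  The theorem is a combination of the three bounds.

open import Defs
open import Algebra.Properties.CommutativeMonoid.Sum as CMSum using ()
open import Data.Bool using (Bool; true; false; T; T?; _xor_)
open import Data.Empty using (⊥; ⊥-elim)
open import Data.Fin as Fin using (Fin; zero; suc; _≟_; toℕ; join; _↑ˡ_; _↑ʳ_)
open import Data.Fin.Properties using (any?; all?; +↔⊎; toℕ-↑ˡ; toℕ-↑ʳ; toℕ<n; toℕ-injective)
open import Data.Fin.Subset using (Subset; _∈_; _∉_; ∣_∣; ⁅_⁆; _∪_; inside; outside)
open import Data.Fin.Subset.Properties using (_∈?_; x∈p∪q⁺; x∈p∪q⁻; x∈⁅x⁆; x∈⁅y⁆⇒x≡y)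
open import Data.List as List using ([]; _∷_)
open import Data.Nat as ℕ
  using (ℕ; zero; suc; _+_; _*_; _∸_; _≤_; _<_; z≤n; s≤s; _≤?_; _<?_)
open import Data.Nat.Properties hiding (_≟_)
open import Data.Nat.Tactic.RingSolver using (solve-∀)
open import Data.Product using (Σ; ∃; ∃-syntax; _×_; _,_; proj₁; proj₂)
open import Data.Sum as Sum using (_⊎_; inj₁; inj₂; [_,_])
open import Data.Sum.Algebra using (⊎-comm)
open import Data.Vec as Vec using ([]; _∷_)
open import Data.Vec.Properties using (lookup⇒[]=; []=⇒lookup; lookup∘tabulate)
open import Function using (_∘_; id)
open import Function.Bundles using (_↔_; Inverse; mk↔ₛ′)
open import Function.Construct.Composition using (_↔-∘_)
open import Function.Construct.Symmetry using (↔-sym)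
open import Relation.Binary.PropositionalEquality
  using (_≡_; _≢_; refl; sym; trans; cong; cong₂; subst; module ≡-Reasoning)
open import Relation.Nullary using (¬_; Dec; yes; no; does)
open import Relation.Nullary.Decidable
  using (_×-dec_; _⊎-dec_; _→-dec_; ¬?; decidable-stable; dec-true)
open import Relation.Unary using (Decidable)
open import Relation.Unary.Properties using (U?)

-- In K_{k,k} every vertex off I is full and no vertex has slack, so nobody can pay; the hypothesis
-- enters through the fact that no vertex has k twins. The remaining obstacle are the near misses of
-- K_{k,k}. On a K_{k-1,k} one may exchange vertices of I for equally many others, so minimality of
-- |I| has nothing to say there. The secondary criterion breaks this tie: such an exchange would
-- create a vertex with k - 1 twins and k - 1 neighbours in I, hence it must destroy another one.
-- That other vertex is adjacent to something exchanged, and this extra edge leads to a vertex of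
-- small d(u) that is able to pay.

module ℕ-Sum = CMSum +-0-commutativeMonoid

-- Sums and counts over finite sets.

opaque
  ∑ : ∀ {n} → (Fin n → ℕ) → ℕ
  ∑ = ℕ-Sum.sum

  ∑-mono : ∀ {n} {f g : Fin n → ℕ} → (∀ i → f i ≤ g i) → ∑ f ≤ ∑ g
  ∑-mono {zero}  f≤g = z≤n
  ∑-mono {suc n} f≤g = +-mono-≤ (f≤g zero) (∑-mono (f≤g ∘ suc))

  ∑-cong : ∀ {n} {f g : Fin n → ℕ} → (∀ i → f i ≡ g i) → ∑ f ≡ ∑ g
  ∑-cong = ℕ-Sum.sum-cong-≗

  ∑-+ : ∀ {n} (f g : Fin n → ℕ) → ∑ (λ i → f i + g i) ≡ ∑ f + ∑ g
  ∑-+ = ℕ-Sum.∑-distrib-+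

  ∑-swap : ∀ {m n} (f : Fin m → Fin n → ℕ) →
           ∑ (λ i → ∑ (λ j → f i j)) ≡ ∑ (λ j → ∑ (λ i → f i j))
  ∑-swap = ℕ-Sum.∑-comm

  ∑-*ˡ : ∀ {n} c (f : Fin n → ℕ) → ∑ (λ i → c * f i) ≡ c * ∑ f
  ∑-*ˡ {zero}  c f = sym (*-zeroʳ c)
  ∑-*ˡ {suc n} c f =
    trans (cong (c * f zero +_) (∑-*ˡ c (f ∘ suc))) (sym (*-distribˡ-+ c _ _))

  ∑-zero : ∀ {n} {f : Fin n → ℕ} → (∀ i → f i ≡ 0) → ∑ f ≡ 0
  ∑-zero {zero}  f≡0 = refl
  ∑-zero {suc n} f≡0 = cong₂ _+_ (f≡0 zero) (∑-zero (f≡0 ∘ suc))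

  ∑-one : ∀ n → ∑ {n} (λ _ → 1) ≡ n
  ∑-one zero    = refl
  ∑-one (suc n) = cong suc (∑-one n)

  term≤∑ : ∀ {n} (f : Fin n → ℕ) x → f x ≤ ∑ f
  term≤∑ f zero    = m≤m+n _ _
  term≤∑ f (suc x) = ≤-trans (term≤∑ (f ∘ suc) x) (m≤n+m _ _)

⟦_⟧ : {A : Set} → Dec A → ℕ
⟦ yes _ ⟧ = 1
⟦ no  _ ⟧ = 0

⟦⟧-yes : {A : Set} (A? : Dec A) → A → ⟦ A? ⟧ ≡ 1
⟦⟧-yes (yes _) a = refl
⟦⟧-yes (no ¬a) a = ⊥-elim (¬a a)

⟦⟧-no : {A : Set} (A? : Dec A) → ¬ A → ⟦ A? ⟧ ≡ 0
⟦⟧-no (yes a) ¬a = ⊥-elim (¬a a)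
⟦⟧-no (no _)  ¬a = refl

⟦⟧-mono : {A B : Set} (A? : Dec A) (B? : Dec B) → (A → B) → ⟦ A? ⟧ ≤ ⟦ B? ⟧
⟦⟧-mono (no _)  B? f = z≤n
⟦⟧-mono (yes a) B? f = ≤-reflexive (sym (⟦⟧-yes B? (f a)))

⟦⟧-⇔ : {A B : Set} (A? : Dec A) (B? : Dec B) → (A → B) → (B → A) → ⟦ A? ⟧ ≡ ⟦ B? ⟧
⟦⟧-⇔ A? B? f g = ≤-antisym (⟦⟧-mono A? B? f) (⟦⟧-mono B? A? g)

⟦⟧-∪ : {A B C : Set} (A? : Dec A) (B? : Dec B) (C? : Dec C) →
       (A → B ⊎ C) → ⟦ A? ⟧ ≤ ⟦ B? ⟧ + ⟦ C? ⟧
⟦⟧-∪ (no _)  B? C? f = z≤n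
⟦⟧-∪ (yes a) B? C? f with f a
... | inj₁ b = ≤-trans (≤-reflexive (sym (⟦⟧-yes B? b))) (m≤m+n _ _)
... | inj₂ c = ≤-trans (≤-reflexive (sym (⟦⟧-yes C? c))) (m≤n+m _ _)

⟦⟧-⊎ : {A B C : Set} (A? : Dec A) (B? : Dec B) (C? : Dec C) →
       (A → C) → (B → C) → (A → ¬ B) → ⟦ A? ⟧ + ⟦ B? ⟧ ≤ ⟦ C? ⟧
⟦⟧-⊎ (no _)  B?      C? f g d = ⟦⟧-mono B? C? g
⟦⟧-⊎ (yes a) (yes b) C? f g d = ⊥-elim (d a b)
⟦⟧-⊎ (yes a) (no _)  C? f g d = ⟦⟧-mono (yes a) C? f

opaque
  # : ∀ {n} {P : Fin n → Set} → Decidable P → ℕ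
  # P? = ∑ (λ x → ⟦ P? x ⟧)

  #≡∑ : ∀ {n} {P : Fin n → Set} (P? : Decidable P) → # P? ≡ ∑ (λ x → ⟦ P? x ⟧)
  #≡∑ P? = refl

module _ {n : ℕ} {P Q : Fin n → Set} {P? : Decidable P} {Q? : Decidable Q} where
  opaque
    unfolding #

    #-mono : (∀ {x} → P x → Q x) → # P? ≤ # Q?
    #-mono f = ∑-mono λ x → ⟦⟧-mono (P? x) (Q? x) f

module _ {n : ℕ} {P Q R : Fin n → Set} {P? : Decidable P} {Q? : Decidable Q} {R? : Decidable R} where
  opaque
    unfolding #

    #-∪ : (∀ {x} → P x → Q x ⊎ R x) → # P? ≤ # Q? + # R?
    #-∪ f = ≤-trans (∑-mono λ x → ⟦⟧-∪ (P? x) (Q? x) (R? x) f)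
                    (≤-reflexive (∑-+ _ _))

    #-⊎ : (∀ {x} → P x → R x) → (∀ {x} → Q x → R x) → (∀ {x} → P x → ¬ Q x) →
          # P? + # Q? ≤ # R?
    #-⊎ f g d = ≤-trans (≤-reflexive (sym (∑-+ _ _)))
                        (∑-mono λ x → ⟦⟧-⊎ (P? x) (Q? x) (R? x) f g d)

module _ {n : ℕ} {P : Fin n → Set} {P? : Decidable P} where
  opaque
    unfolding #

    #-empty : (∀ {x} → ¬ P x) → # P? ≡ 0
    #-empty ¬p = ∑-zero λ x → ⟦⟧-no (P? x) ¬p

    ⟦⟧≤# : ∀ x → ⟦ P? x ⟧ ≤ # P?
    ⟦⟧≤# = term≤∑ (λ x → ⟦ P? x ⟧)

  opaque
    #-∃ : 1 ≤ # P? → ∃ P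
    #-∃ 1≤ with any? P?
    ... | yes p = p
    ... | no ¬p = ⊥-elim (<⇒≱ 1≤ (≤-reflexive (#-empty λ {x} px → ¬p (x , px))))

  #-inhabited : ∀ {x} → P x → 1 ≤ # P?
  #-inhabited {x} px = ≤-trans (≤-reflexive (sym (⟦⟧-yes (P? x) px))) (⟦⟧≤# x)

opaque
  unfolding # ∑

  #-singleton≤1 : ∀ {n} (x : Fin n) → # (_≟ x) ≤ 1
  #-singleton≤1 {suc n} zero =
    s≤s (≤-reflexive (∑-zero {n} λ i → ⟦⟧-no (suc i ≟ zero) λ ()))
  #-singleton≤1 {suc n} (suc x) = +-mono-≤ (≤-reflexive (⟦⟧-no (zero ≟ suc x) λ ()))
    (≤-trans (∑-mono {n} λ i → ⟦⟧-mono (suc i ≟ suc x) (i ≟ x) λ { refl → refl }) (#-singleton≤1 x))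

#-singleton : ∀ {n} (x : Fin n) → # (_≟ x) ≡ 1
#-singleton x = ≤-antisym (#-singleton≤1 x) (#-inhabited refl)

module _ {n : ℕ} {P : Fin n → Set} {P? : Decidable P} where

  #-unique : (∀ {x y} → P x → P y → x ≡ y) → # P? ≤ 1
  #-unique u with any? P?
  ... | yes (x , px) = ≤-trans (#-mono λ py → u py px) (#-singleton≤1 x)
  ... | no ¬p = ≤-trans (≤-reflexive (#-empty λ {x} px → ¬p (x , px))) z≤n

  #-pair : ∀ {x y} → P x → P y → x ≢ y → 2 ≤ # P?
  #-pair {x} {y} px py x≢y = ≤-trans
    (≤-reflexive (sym (cong₂ _+_ (#-singleton x) (#-singleton y))))
    (#-⊎ {P? = _≟ x} {Q? = _≟ y} (λ { refl → px }) (λ { refl → py }) λ { refl → x≢y })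

  #-all : (∀ x → P x) → # P? ≡ n
  #-all p = trans (#≡∑ P?) (trans (∑-cong λ x → ⟦⟧-yes (P? x) (p x)) (∑-one n))

#≤n : ∀ {n} {P : Fin n → Set} {P? : Decidable P} → # P? ≤ n
#≤n {n} = ≤-trans (#-mono {Q? = U?} _) (≤-reflexive (#-all _))

module _ {n : ℕ} {P Q : Fin n → Set} {P? : Decidable P} {Q? : Decidable Q} where

  #-cong : (∀ {x} → P x → Q x) → (∀ {x} → Q x → P x) → # P? ≡ # Q?
  #-cong f g = ≤-antisym (#-mono f) (#-mono g)

  opaque
    #-∃∖ : # P? < # Q? → ∃[ x ] Q x × ¬ P x
    #-∃∖ p<q with any? (λ x → Q? x ×-dec ¬? (P? x))
    ... | yes e = e
    ... | no ¬e = ⊥-elim (<⇒≱ p<q (#-mono λ {x} qx →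
                    decidable-stable (P? x) λ ¬px → ¬e (x , qx , ¬px)))

  #-strict : (∀ {x} → P x → Q x) → ∀ {y} → Q y → ¬ P y → suc (# P?) ≤ # Q?
  #-strict f {y} qy ¬py = ≤-trans
    (≤-reflexive (trans (+-comm 1 _) (cong (# P? +_) (sym (#-singleton y)))))
    (#-⊎ {P? = P?} {Q? = _≟ y} f (λ { refl → qy }) λ { py refl → ¬py py })

  -- This turns a tight count into an inclusion, which is how neighbourhoods are determined exactly
  -- later on.
  #-⊇ : (∀ {x} → P x → Q x) → # Q? ≤ # P? → ∀ {x} → Q x → P x
  #-⊇ f q≤p {x} qx = decidable-stable (P? x) λ ¬px → <⇒≱ (#-strict f qx ¬px) q≤p

#-swap : ∀ {m n} {M : Fin m → Fin n → Set} (M? : ∀ x y → Dec (M x y)) →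
         ∑ (λ x → # (M? x)) ≡ ∑ (λ y → # (λ x → M? x y))
#-swap M? = trans (∑-cong λ x → #≡∑ (M? x))
  (trans (∑-swap λ x y → ⟦ M? x y ⟧) (∑-cong λ y → sym (#≡∑ (λ x → M? x y))))

-- Double counting of the pairs in `M`: each `x` with `P x` lies in at least one pair, each `y` in
-- at most `c y`.
#-cover : ∀ {m n} {P : Fin m → Set} {M : Fin m → Fin n → Set}
          (P? : Decidable P) (M? : ∀ x y → Dec (M x y)) (c : Fin n → ℕ) →
          (∀ {x} → P x → ∃ (M x)) → (∀ y → # (λ x → M? x y) ≤ c y) → # P? ≤ ∑ c
#-cover P? M? c ex bound = ≤-trans (≤-reflexive (#≡∑ P?)) (≤-trans
  (∑-mono λ x → le x (P? x))
  (≤-trans (≤-reflexive (#-swap M?)) (∑-mono bound)))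
  where
  le : ∀ x (d : Dec _) → ⟦ d ⟧ ≤ # (M? x)
  le x (no _)  = z≤n
  le x (yes p) = #-inhabited (proj₂ (ex p))

module _ {n : ℕ} {P : Fin n → Set} {P? : Decidable P} where

  #-remove : ∀ {y} → P y → # P? ≡ suc (# (λ x → P? x ×-dec ¬? (x ≟ y)))
  #-remove {y} py = ≤-antisym
    (≤-trans (#-∪ {Q? = _≟ y} {R? = λ x → P? x ×-dec ¬? (x ≟ y)} split)
             (+-monoˡ-≤ _ (≤-reflexive (#-singleton y))))
    (#-strict proj₁ py λ (_ , y≢y) → y≢y refl)
    where
    split : ∀ {x} → P x → x ≡ y ⊎ (P x × x ≢ y)
    split {x} px with x ≟ y
    ... | yes x≡y = inj₁ x≡y
    ... | no x≢y  = inj₂ (px , x≢y)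

length-filter : ∀ {n} {A : Set} {P : A → Set} (P? : Decidable P) (f : Fin n → A) →
                List.length (List.filter P? (List.tabulate f)) ≡ # (P? ∘ f)
length-filter P? f = trans (go f) (sym (#≡∑ (P? ∘ f)))
  where
  opaque
    unfolding ∑
    go : ∀ {n} (f : Fin n → _) →
         List.length (List.filter P? (List.tabulate f)) ≡ ∑ (λ i → ⟦ P? (f i) ⟧)
    go {zero}  f = refl
    go {suc n} f with P? (f zero)
    ... | yes _ = cong suc (go (f ∘ suc))
    ... | no _  = go (f ∘ suc)

∣∣≡# : ∀ {n} (S : Subset n) → ∣ S ∣ ≡ # (_∈? S)
∣∣≡# S = trans (go S) (sym (#≡∑ (_∈? S)))
  where
  opaque
    unfolding ∑
    tail : ∀ {n b} (S : Subset n) → ∑ (λ i → ⟦ i ∈? S ⟧) ≡ ∑ (λ i → ⟦ suc i ∈? (b ∷ S) ⟧)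
    tail S = ∑-cong λ i → ⟦⟧-⇔ (i ∈? S) (suc i ∈? (_ ∷ S)) Vec.there λ { (Vec.there p) → p }

    go : ∀ {n} (S : Subset n) → ∣ S ∣ ≡ ∑ (λ i → ⟦ i ∈? S ⟧)
    go []            = refl
    go (inside ∷ S)  = cong suc (trans (go S) (tail S))
    go (outside ∷ S) = trans (go S) (tail S)

module _ {n : ℕ} {P : Fin n → Set} where

  ⟪_⟫ : Decidable P → Subset n
  ⟪ P? ⟫ = Vec.tabulate (does ∘ P?)

  ∈⟪⟫⁺ : (P? : Decidable P) → ∀ {x} → P x → x ∈ ⟪ P? ⟫
  ∈⟪⟫⁺ P? {x} px = lookup⇒[]= x _ (trans (lookup∘tabulate _ x) (dec-true (P? x) px))

  ∈⟪⟫⁻ : (P? : Decidable P) → ∀ {x} → x ∈ ⟪ P? ⟫ → P x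
  ∈⟪⟫⁻ P? {x} x∈ with P? x | trans (sym (lookup∘tabulate (does ∘ P?) x)) ([]=⇒lookup x∈)
  ... | yes px | _ = px

-- Independent sets: greedy extension and exchange.

module Neighbours {n : ℕ} (G : Graph n) where

  infix 4 _~_ _~?_
  _~_ : Fin n → Fin n → Set
  _~_ = Adj G

  _~?_ : ∀ u v → Dec (u ~ v)
  u ~? v = T? (adj G u v)

  ~-sym : ∀ {u v} → u ~ v → v ~ u
  ~-sym {u} {v} = subst T (adj-sym G u v)

  ~-irr : ∀ {v} → ¬ v ~ v
  ~-irr {v} = subst T (adj-irr G v)

  degree≡# : ∀ v → degree G v ≡ # (v ~?_)
  degree≡# v = length-filter (v ~?_) id

  d : Subset n → Fin n → ℕ
  d S v = # (λ x → (v ~? x) ×-dec (x ∈? S))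

  opaque
    extend-within : {D : Fin n → Set} (D? : Decidable D) (S : Subset n) → Independent G S →
                    ∃[ J ] Independent G J × (∀ v → D v → v ∉ J → ∃[ u ] u ∈ J × v ~ u)
                         × (∀ {x} → x ∈ S → x ∈ J) × (∀ {x} → x ∈ J → x ∈ S ⊎ D x)
    extend-within {D} D? S = go (n ∸ # (_∈? S)) S (m≤n+m∸n n (# (_∈? S)))
      where
      -- The fuel `m` bounds the number of vertices outside `S`; each round adds one undominated
      -- vertex of `D`.
      go : ∀ m S → n ≤ # (_∈? S) + m → Independent G S →
           ∃[ J ] Independent G J × (∀ v → D v → v ∉ J → ∃[ u ] u ∈ J × v ~ u)
                × (∀ {x} → x ∈ S → x ∈ J) × (∀ {x} → x ∈ J → x ∈ S ⊎ D x)
      go m S bound ind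
        with any? (λ v → D? v ×-dec ¬? (v ∈? S) ×-dec ¬? (any? λ u → (u ∈? S) ×-dec (v ~? u)))
      ... | no dominated = S , ind , (λ v Dv v∉S →
              decidable-stable (any? λ u → (u ∈? S) ×-dec (v ~? u)) λ ¬e → dominated (v , Dv , v∉S , ¬e))
              , id , inj₁
      go zero S bound ind | yes (v , _ , v∉S , _) = ⊥-elim (<⇒≱
        (≤-trans (#-strict {P? = _∈? S} {Q? = U?} _ _ v∉S) (≤-reflexive (#-all _)))
        (≤-trans bound (≤-reflexive (+-identityʳ _))))
      go (suc m) S bound ind | yes (v , Dv , v∉S , ¬e)
        with go m (S ∪ ⁅ v ⁆) (≤-trans bound (≤-trans (≤-reflexive (+-suc _ m))
                  (+-monoˡ-≤ m (#-strict (x∈p∪q⁺ ∘ inj₁) (x∈p∪q⁺ (inj₂ (x∈⁅x⁆ v))) v∉S)))) ind′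
        where
        ind′ : Independent G (S ∪ ⁅ v ⁆)
        ind′ x y x∈ y∈ x~y with x∈p∪q⁻ S _ x∈ | x∈p∪q⁻ S _ y∈
        ... | inj₁ x∈S | inj₁ y∈S = ind x y x∈S y∈S x~y
        ... | inj₁ x∈S | inj₂ y∈v rewrite x∈⁅y⁆⇒x≡y v y∈v = ¬e (x , x∈S , ~-sym x~y)
        ... | inj₂ x∈v | inj₁ y∈S rewrite x∈⁅y⁆⇒x≡y v x∈v = ¬e (y , y∈S , x~y)
        ... | inj₂ x∈v | inj₂ y∈v rewrite x∈⁅y⁆⇒x≡y v x∈v | x∈⁅y⁆⇒x≡y v y∈v = ~-irr x~y
      ... | J , indJ , domJ , S∪v⊆J , J⊆ = J , indJ , domJ , S∪v⊆J ∘ x∈p∪q⁺ ∘ inj₁ , from-S ∘ J⊆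
        where
        from-S : ∀ {x} → x ∈ S ∪ ⁅ v ⁆ ⊎ D x → x ∈ S ⊎ D x
        from-S (inj₂ Dx) = inj₂ Dx
        from-S (inj₁ x∈) with x∈p∪q⁻ S _ x∈
        ... | inj₁ x∈S = inj₁ x∈S
        ... | inj₂ x∈v rewrite x∈⁅y⁆⇒x≡y v x∈v = inj₂ Dv

    extend : (S : Subset n) → Independent G S →
             ∃[ J ] IndependentDominating G J × (∀ {x} → x ∈ S → x ∈ J)
    extend S ind with extend-within U? S ind
    ... | J , indJ , domJ , S⊆J , _ = J , (indJ , λ v → domJ v _) , S⊆J

  -- W replaces its neighbours in I, the vertices hit; only free vertices may have to be added.
  module Exchange (I : Subset n) (ind : Independent G I)
    {W : Fin n → Set} (W? : Decidable W)
    (W-ind : ∀ {x y} → W x → W y → ¬ x ~ y) (W∉I : ∀ {x} → W x → x ∉ I) where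

    Hit : Fin n → Set
    Hit x = x ∈ I × ∃[ w ] W w × w ~ x

    hit? : Decidable Hit
    hit? x = (x ∈? I) ×-dec any? (λ w → W? w ×-dec (w ~? x))

    Free : Fin n → Set
    Free z = z ∉ I × ¬ W z × (∀ x → z ~ x → x ∈ I → Hit x) × (∀ w → W w → ¬ z ~ w)

    free? : Decidable Free
    free? z = ¬? (z ∈? I) ×-dec ¬? (W? z)
              ×-dec all? (λ x → (z ~? x) →-dec ((x ∈? I) →-dec hit? x))
              ×-dec all? (λ w → W? w →-dec ¬? (z ~? w))

    Kept : Fin n → Set
    Kept x = x ∈ I × ¬ Hit x

    kept? : Decidable Kept
    kept? x = (x ∈? I) ×-dec ¬? (hit? x)

    opaque
      exchange : ∃[ J ] IndependentDominating G J
                      × (∀ {x} → Kept x ⊎ W x → x ∈ J)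
                      × (∀ {x} → x ∈ J → (Kept x ⊎ W x) ⊎ Free x)
      exchange with extend ⟪ base? ⟫ base-ind
        where
        base? : Decidable (λ x → Kept x ⊎ W x)
        base? x = kept? x ⊎-dec W? x
        base-ind : Independent G ⟪ base? ⟫
        base-ind x y x∈ y∈ x~y with ∈⟪⟫⁻ base? x∈ | ∈⟪⟫⁻ base? y∈
        ... | inj₁ (x∈I , _) | inj₁ (y∈I , _) = ind x y x∈I y∈I x~y
        ... | inj₁ (x∈I , ¬h) | inj₂ wy = ¬h (x∈I , y , wy , ~-sym x~y)
        ... | inj₂ wx | inj₁ (y∈I , ¬h) = ¬h (y∈I , x , wx , x~y)
        ... | inj₂ wx | inj₂ wy = W-ind wx wy x~y
      ... | J , (indJ , domJ) , sup = J , (indJ , domJ) , sup′ , classify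
        where
        base? : Decidable (λ x → Kept x ⊎ W x)
        base? x = kept? x ⊎-dec W? x
        sup′ : ∀ {x} → Kept x ⊎ W x → x ∈ J
        sup′ b = sup (∈⟪⟫⁺ base? b)
        classify : ∀ {x} → x ∈ J → (Kept x ⊎ W x) ⊎ Free x
        classify {x} x∈J with base? x
        ... | yes b = inj₁ b
        ... | no ¬b = inj₂
          ( (λ x∈I → ¬b (inj₁ (x∈I , λ (_ , w , ww , w~x) → indJ w x (sup′ (inj₂ ww)) x∈J w~x)))
          , (λ wx → ¬b (inj₂ wx))
          , (λ y x~y y∈I → decidable-stable (hit? y) λ ¬h →
               indJ x y x∈J (sup′ (inj₁ (y∈I , ¬h))) x~y)
          , λ w ww x~w → indJ x w x∈J (sup′ (inj₂ ww)) x~w)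

    ∣I∣≡ : # (_∈? I) ≡ # hit? + # kept?
    ∣I∣≡ = ≤-antisym (#-∪ λ {x} x∈I → split x∈I (hit? x))
                     (#-⊎ proj₁ proj₁ λ h (_ , ¬h) → ¬h h)
      where
      split : ∀ {x} → x ∈ I → Dec (Hit x) → Hit x ⊎ Kept x
      split x∈I (yes h) = inj₁ h
      split x∈I (no ¬h) = inj₂ (x∈I , ¬h)

    module _ (min : ∀ J → IndependentDominating G J → # (_∈? I) ≤ # (_∈? J)) where

      -- Minimality of `I` against the set `J` of `exchange`, which loses the hit vertices and gains
      -- at most `W` and the free ones.
      #hit≤ : # hit? ≤ # W? + # free?
      #hit≤ with exchange
      ... | J , ids , _ , classify = +-cancelʳ-≤ (# kept?) _ _ (begin
        # hit? + # kept?              ≡⟨ ∣I∣≡ ⟨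
        # (_∈? I)                     ≤⟨ min J ids ⟩
        # (_∈? J)                     ≤⟨ #-∪ {Q? = λ x → kept? x ⊎-dec W? x} classify ⟩
        # (λ x → kept? x ⊎-dec W? x) + # free?
                                      ≤⟨ +-monoˡ-≤ _ (#-∪ {Q? = kept?} {R? = W?} id) ⟩
        (# kept? + # W?) + # free?    ≡⟨ +-assoc (# kept?) _ _ ⟩
        # kept? + (# W? + # free?)    ≡⟨ +-comm (# kept?) _ ⟩
        (# W? + # free?) + # kept?    ∎)
        where open ≤-Reasoning

-- Recognising K_{k,k}; twins.

isLeft : {A B : Set} → A ⊎ B → Bool
isLeft (inj₁ _) = true
isLeft (inj₂ _) = false

private
  insertˡ : ∀ {n a b} → Fin n ↔ (Fin a ⊎ Fin b) → Fin (suc n) ↔ (Fin (suc a) ⊎ Fin b)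
  insertˡ {n} {a} {b} f = mk↔ₛ′ to from to-from from-to
    where
    open Inverse f using (strictlyInverseˡ; strictlyInverseʳ) renaming (to to to′; from to from′)
    to : Fin (suc n) → Fin (suc a) ⊎ Fin b
    to zero    = inj₁ zero
    to (suc i) = Sum.map suc id (to′ i)
    from : Fin (suc a) ⊎ Fin b → Fin (suc n)
    from (inj₁ zero)    = zero
    from (inj₁ (suc i)) = suc (from′ (inj₁ i))
    from (inj₂ j)       = suc (from′ (inj₂ j))
    to-from : ∀ s → to (from s) ≡ s
    to-from (inj₁ zero)    = refl
    to-from (inj₁ (suc i)) = cong (Sum.map suc id) (strictlyInverseˡ (inj₁ i))
    to-from (inj₂ j)       = cong (Sum.map suc id) (strictlyInverseˡ (inj₂ j))
    from-map : ∀ (s : Fin a ⊎ Fin b) → from (Sum.map suc id s) ≡ suc (from′ s)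
    from-map (inj₁ _) = refl
    from-map (inj₂ _) = refl
    from-to : ∀ i → from (to i) ≡ i
    from-to zero    = refl
    from-to (suc i) = trans (from-map (to′ i)) (cong suc (strictlyInverseʳ i))

  insertʳ : ∀ {n a b} → Fin n ↔ (Fin a ⊎ Fin b) → Fin (suc n) ↔ (Fin a ⊎ Fin (suc b))
  insertʳ f = ⊎-comm _ _ ↔-∘ insertˡ (⊎-comm _ _ ↔-∘ f)

  isLeft-insertˡ : ∀ {n a b} (f : Fin n ↔ (Fin a ⊎ Fin b)) i →
                   isLeft (Inverse.to (insertˡ f) (suc i)) ≡ isLeft (Inverse.to f i)
  isLeft-insertˡ f i with Inverse.to f i
  ... | inj₁ _ = refl
  ... | inj₂ _ = refl

  isLeft-insertʳ : ∀ {n a b} (f : Fin n ↔ (Fin a ⊎ Fin b)) i →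
                   isLeft (Inverse.to (insertʳ f) (suc i)) ≡ isLeft (Inverse.to f i)
  isLeft-insertʳ f i with Inverse.to f i
  ... | inj₁ _ = refl
  ... | inj₂ _ = refl

-- Each vertex is inserted at the front of its own side, so that the sizes of the two sides come out
-- as the two counts.
separate : ∀ {n} {P : Fin n → Set} (P? : Decidable P) →
           Σ (Fin n ↔ (Fin (# P?) ⊎ Fin (# (λ x → ¬? (P? x))))) λ f →
           ∀ x → isLeft (Inverse.to f x) ≡ does (P? x)
separate P? rewrite #≡∑ P? | #≡∑ (λ x → ¬? (P? x)) = go P?
  where
  opaque
    unfolding ∑
    go : ∀ {n} {P : Fin n → Set} (P? : Decidable P) →
         Σ (Fin n ↔ (Fin (∑ λ x → ⟦ P? x ⟧) ⊎ Fin (∑ λ x → ⟦ ¬? (P? x) ⟧))) λ f →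
         ∀ x → isLeft (Inverse.to f x) ≡ does (P? x)
    go {zero}  P? = mk↔ₛ′ (λ ()) [ (λ ()) , (λ ()) ] [ (λ ()) , (λ ()) ] (λ ()) , λ ()
    go {suc n} P? with P? zero in eq | go (P? ∘ suc)
    ... | yes p | f , side-f = insertˡ f , λ { zero → sym (cong does eq)
                                            ; (suc i) → trans (isLeft-insertˡ f i) (side-f i) }
    ... | no ¬p | f , side-f = insertʳ f , λ { zero → sym (cong does eq)
                                            ; (suc i) → trans (isLeft-insertʳ f i) (side-f i) }

side-join : ∀ k (s : Fin k ⊎ Fin k) → side k (join k k s) ≡ isLeft s
side-join k (inj₁ i) with toℕ (i ↑ˡ k) <? k
... | yes _ = refl
... | no ¬p = ⊥-elim (¬p (≤-trans (s≤s (≤-reflexive (toℕ-↑ˡ i k))) (toℕ<n i)))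
side-join k (inj₂ i) with toℕ (k ↑ʳ i) <? k
... | no _  = refl
... | yes p = ⊥-elim (<⇒≱ p (≤-trans (m≤m+n k _) (≤-reflexive (sym (toℕ-↑ʳ k i)))))

bipartition⇒Iso : ∀ {n} (G : Graph n) {P : Fin n → Set} (P? : Decidable P) {k} →
                  # P? ≡ k → # (λ x → ¬? (P? x)) ≡ k →
                  (∀ u v → adj G u v ≡ does (P? u) xor does (P? v)) → Iso G (K k)
bipartition⇒Iso G P? #P≡k #¬P≡k adj≡ with separate P?
... | f , side-f rewrite #P≡k | #¬P≡k = ↔-sym +↔⊎ ↔-∘ f , λ u v →
  trans (adj≡ u v) (cong₂ _xor_ (side≡ u) (side≡ v))
  where
  side≡ : ∀ u → _ ≡ side _ (join _ _ (Inverse.to f u))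
  side≡ u = sym (trans (side-join _ (Inverse.to f u)) (side-f u))

module Twins {n : ℕ} (G : Graph n) where
  open Neighbours G

  -- One inclusion is enough: regularity makes the neighbourhoods equal (`twin-sym`). A vertex is
  -- its own twin.
  Twin : Fin n → Fin n → Set
  Twin v u = ∀ x → v ~ x → u ~ x

  twin? : ∀ v u → Dec (Twin v u)
  twin? v u = all? λ x → (v ~? x) →-dec (u ~? x)

  module _ {k : ℕ} (reg : ∀ v → # (v ~?_) ≡ k) where

    twin-sym : ∀ {v u} → Twin v u → Twin u v
    twin-sym {v} {u} t x = #-⊇ (λ {x} → t x) (≤-reflexive (trans (reg u) (sym (reg v)))) {x}

    -- If the set A of twins of `v` had k elements, each vertex of N(v) would have A as its whole
    -- neighbourhood, and each vertex of A has N(v). Then A and N(v) together are closed under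
    -- adjacency, by connectedness they are everything, and G is K_{k,k}.
    #twins<k : 1 ≤ k → Connected G → ¬ Iso G (K k) → ∀ v → # (twin? v) < k
    #twins<k 1≤k conn ¬iso v = ≰⇒> λ k≤t → ¬iso (iso k≤t)
      where
      iso : k ≤ # (twin? v) → Iso G (K k)
      iso k≤t = bipartition⇒Iso G (twin? v) #A≡k
          (trans (#-cong (λ {u} → ¬A⇒B) (λ v~u A → disjoint A v~u)) (reg v)) adj≡
        where
        A = Twin v
        B = v ~_

        B~⇒A : ∀ {b x} → B b → b ~ x → A x
        B~⇒A {b} v~b = #-⊇ {P? = twin? v} (λ t → ~-sym (t b v~b)) (≤-trans (≤-reflexive (reg b)) k≤t)

        A~⇒B : ∀ {a x} → A a → a ~ x → B x
        A~⇒B t = twin-sym t _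

        disjoint : ∀ {a} → A a → ¬ B a
        disjoint t v~a = ~-irr (t _ v~a)

        closed : ∀ {u w} → Reach G u w → A u ⊎ B u → A w ⊎ B w
        closed Defs.here s                   = s
        closed (Defs.step u~x r) (inj₁ a) = closed r (inj₂ (A~⇒B a u~x))
        closed (Defs.step u~x r) (inj₂ b) = closed r (inj₁ (B~⇒A b u~x))

        ¬A⇒B : ∀ {u} → ¬ A u → B u
        ¬A⇒B {u} ¬a with closed (conn v u) (inj₁ λ _ → id)
        ... | inj₁ a = ⊥-elim (¬a a)
        ... | inj₂ b = b

        #A≡k : # (twin? v) ≡ k
        #A≡k with #-∃ {P? = v ~?_} (≤-trans 1≤k (≤-reflexive (sym (reg v))))
        ... | b , v~b = ≤-antisym
          (≤-trans (#-mono λ t → ~-sym (t b v~b)) (≤-reflexive (reg b))) k≤t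

        T≡ : ∀ {b} → ¬ T b → b ≡ false
        T≡ {false} _ = refl
        T≡ {true} ¬t = ⊥-elim (¬t _)
        T≡′ : ∀ {b} → T b → b ≡ true
        T≡′ {true} _ = refl

        adj-xor : ∀ {u w} (a? : Dec (A u)) (a′? : Dec (A w)) → adj G u w ≡ does a? xor does a′?
        adj-xor (yes a) (yes a′) = T≡ λ u~w → disjoint a′ (A~⇒B a u~w)
        adj-xor (yes a) (no ¬a′) = T≡′ (a _ (¬A⇒B ¬a′))
        adj-xor (no ¬a) (yes a′) = T≡′ (~-sym (a′ _ (¬A⇒B ¬a)))
        adj-xor (no ¬a) (no ¬a′) = T≡ λ u~w → ¬a′ (B~⇒A (¬A⇒B ¬a) u~w)

        adj≡ : ∀ u w → adj G u w ≡ does (twin? v u) xor does (twin? v w)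
        adj≡ u w = adj-xor (twin? v u) (twin? v w)

-- The choice of I and what its optimality gives.

module Rank {n : ℕ} (G : Graph n) (k : ℕ) where
  open Neighbours G
  open Twins G

  -- Given `#twin<k` this means exactly k - 1 twins, which form a K_{k-1,k} with their common
  -- neighbourhood.
  Rich : Fin n → Set
  Rich v = k ≤ suc (# (twin? v))

  rich? : Decidable Rich
  rich? v = k ≤? suc (# (twin? v))

  Ranked : Subset n → Fin n → Set
  Ranked S v = Rich v × suc (d S v) ≡ k

  ranked? : ∀ S → Decidable (Ranked S)
  ranked? S v = rich? v ×-dec (suc (d S v) ℕ.≟ k)

  rank : Subset n → ℕ
  rank S = # (ranked? S)

module Extremal {n : ℕ} (G : Graph n) (k : ℕ) (4≤k : 4 ≤ k)
  (reg : ∀ v → # (Neighbours._~?_ G v) ≡ k)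
  (#twin<k : ∀ v → # (Twins.twin? G v) < k)
  (I : Subset n) (ids : IndependentDominating G I)
  (min : ∀ J → IndependentDominating G J → # (_∈? I) ≤ # (_∈? J))
  (max : ∀ J → IndependentDominating G J → # (_∈? J) ≤ # (_∈? I) → Rank.rank G k J ≤ Rank.rank G k I)
  where

  open Neighbours G public
  open Twins G public
  open Rank G k public

  ind : ∀ {x y} → x ∈ I → y ∈ I → ¬ x ~ y
  ind = proj₁ ids _ _

  dominated : ∀ {v} → v ∉ I → ∃[ x ] x ∈ I × v ~ x
  dominated = proj₂ ids _

  3≤k : 3 ≤ k
  3≤k = ≤-trans (n≤1+n 3) 4≤k

  2≤k : 2 ≤ k
  2≤k = ≤-trans (n≤1+n 2) 3≤k

  dI : Fin n → ℕ
  dI = d I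

  private-nbr? : ∀ v → Decidable (λ x → v ~ x × x ∈ I)
  private-nbr? v x = (v ~? x) ×-dec (x ∈? I)

  dI≤k : ∀ v → dI v ≤ k
  dI≤k v = ≤-trans (#-mono proj₁) (≤-reflexive (reg v))

  ∈⇒dI≡0 : ∀ {v} → v ∈ I → dI v ≡ 0
  ∈⇒dI≡0 v∈I = #-empty λ (v~x , x∈I) → ind v∈I x∈I v~x

  1≤dI⇒∉ : ∀ {v} → 1 ≤ dI v → v ∉ I
  1≤dI⇒∉ 1≤ v∈I = <⇒≱ 1≤ (≤-reflexive (∈⇒dI≡0 v∈I))

  ∉⇒1≤dI : ∀ {v} → v ∉ I → 1 ≤ dI v
  ∉⇒1≤dI v∉I with dominated v∉I
  ... | x , x∈I , v~x = #-inhabited (v~x , x∈I)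

  Full : Fin n → Set
  Full v = dI v ≡ k

  full? : Decidable Full
  full? v = dI v ℕ.≟ k

  full⇒∉ : ∀ {v} → Full v → v ∉ I
  full⇒∉ full = 1≤dI⇒∉ (≤-trans (≤-trans (n≤1+n 1) 2≤k) (≤-reflexive (sym full)))

  full⇒∈ : ∀ {v x} → Full v → v ~ x → x ∈ I
  full⇒∈ {v} full v~x = proj₂ (#-⊇ {P? = private-nbr? v} {Q? = v ~?_} proj₁
    (≤-reflexive (trans (reg v) (sym full))) v~x)

  near : ∀ {v} → suc (dI v) ≡ k → v ∉ I × ¬ Full v
  near near = 1≤dI⇒∉ (≤-pred (≤-trans 2≤k (≤-reflexive (sym near))))
            , λ full → 1+n≢n (trans near (sym full))

  -- u ⊑ w means N(u) ∩ I ⊆ N(w).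
  infix 4 _⊑_ _⊑?_
  _⊑_ : Fin n → Fin n → Set
  u ⊑ w = ∀ x → u ~ x → x ∈ I → w ~ x

  _⊑?_ : ∀ u w → Dec (u ⊑ w)
  u ⊑? w = all? λ x → (u ~? x) →-dec ((x ∈? I) →-dec (w ~? x))

  ⊑-refl : ∀ {u} → u ⊑ u
  ⊑-refl x u~x _ = u~x

  ⊑-trans : ∀ {u v w} → u ⊑ v → v ⊑ w → u ⊑ w
  ⊑-trans u⊑v v⊑w x u~x x∈I = v⊑w x (u⊑v x u~x x∈I) x∈I

  ⊑⇒≤ : ∀ {u w} → u ⊑ w → dI u ≤ dI w
  ⊑⇒≤ u⊑w = #-mono λ (u~x , x∈I) → u⊑w _ u~x x∈I , x∈I

  ⊑∧≥⇒⊒ : ∀ {u w} → u ⊑ w → dI w ≤ dI u → w ⊑ u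
  ⊑∧≥⇒⊒ {u} {w} u⊑w w≤u x w~x x∈I = proj₁
    (#-⊇ {P? = private-nbr? u} {Q? = private-nbr? w}
         (λ (u~x , x∈I) → u⊑w _ u~x x∈I , x∈I) w≤u (w~x , x∈I))

  leaf-unique : ∀ {u x y} → dI u ≡ 1 → u ~ x → x ∈ I → u ~ y → y ∈ I → x ≡ y
  leaf-unique {u} {x} {y} leaf u~x x∈I u~y y∈I = decidable-stable (x ≟ y) λ x≢y →
    <⇒≱ (#-pair {P? = private-nbr? u} (u~x , x∈I) (u~y , y∈I) x≢y) (≤-reflexive leaf)

  unique⇒leaf : ∀ {u q} → u ∉ I → (∀ {x} → u ~ x → x ∈ I → x ≡ q) → dI u ≡ 1
  unique⇒leaf u∉I uniq = ≤-antisym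
    (#-unique λ (u~x , x∈I) (u~y , y∈I) → trans (uniq u~x x∈I) (sym (uniq u~y y∈I)))
    (∉⇒1≤dI u∉I)

  leaf⊑ : ∀ {u q w} → dI u ≡ 1 → u ~ q → q ∈ I → w ~ q → u ⊑ w
  leaf⊑ leaf u~q q∈I w~q x u~x x∈I = subst (_ ~_) (leaf-unique leaf u~q q∈I u~x x∈I) w~q

  -- Degree k leaves room for one neighbour outside a set of k - 1. On a K_{k-1,k} this identifies
  -- the last neighbour.
  almost-all : ∀ s {P : Fin n → Set} (P? : Decidable P) → (∀ {z} → P z → s ~ z) → k ≤ suc (# P?) →
               ∀ {x y} → s ~ x → s ~ y → ¬ P x → ¬ P y → x ≡ y
  almost-all s P? P⊆ k≤ {x} {y} s~x s~y ¬px ¬py = decidable-stable (x ≟ y) λ x≢y →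
    1+n≰n (≤-trans (s≤s k≤) (≤-trans (≤-reflexive (+-comm 2 _)) (≤-trans
      (+-monoʳ-≤ (# P?) (#-pair {P? = pair?} (inj₁ refl) (inj₂ refl) x≢y))
      (≤-trans (#-⊎ {P? = P?} {Q? = pair?} {R? = s ~?_} P⊆
                    (λ { (inj₁ refl) → s~x ; (inj₂ refl) → s~y })
                    λ { px (inj₁ refl) → ¬px px ; py (inj₂ refl) → ¬py py })
               (≤-reflexive (reg s))))))
    where
    pair? : Decidable (λ z → z ≡ x ⊎ z ≡ y)
    pair? z = (z ≟ x) ⊎-dec (z ≟ y)

  opaque
    almost-all′ : ∀ s {P : Fin n → Set} (P? : Decidable P) → (∀ {z} → P z → s ~ z) → k ≤ suc (# P?) →
                  ∀ {y} → s ~ y → ¬ P y → ∀ {x} → s ~ x → P x ⊎ x ≡ y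
    almost-all′ s P? P⊆ k≤ s~y ¬py {x} s~x with P? x
    ... | yes px = inj₁ px
    ... | no ¬px = inj₂ (almost-all s P? P⊆ k≤ s~x s~y ¬px ¬py)

  exchange₁ : ∀ {y} → y ∉ I →
              dI y ≤ suc (# (λ z → ¬? (z ∈? I) ×-dec ¬? (z ≟ y) ×-dec (z ⊑? y) ×-dec ¬? (z ~? y)))
  exchange₁ {y} y∉I = begin
    dI y                  ≤⟨ #-mono (λ (y~x , x∈I) → x∈I , y , refl , y~x) ⟩
    # X.hit?              ≤⟨ X.#hit≤ min ⟩
    # (_≟ y) + # X.free?  ≤⟨ +-mono-≤ (#-singleton≤1 y) (#-mono λ (z∉I , z≢y , hit , z≁) →
                               z∉I , z≢y , (λ x z~x x∈I → hit⇒~ (hit x z~x x∈I)) , z≁ y refl) ⟩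
    _                     ∎
    where
    open ≤-Reasoning
    self-ind : ∀ {x z} → x ≡ y → z ≡ y → ¬ x ~ z
    self-ind refl refl = ~-irr
    self∉I : ∀ {x} → x ≡ y → x ∉ I
    self∉I refl = y∉I
    module X = Exchange I (proj₁ ids) (_≟ y) self-ind self∉I
    hit⇒~ : ∀ {x} → X.Hit x → y ~ x
    hit⇒~ (_ , _ , refl , y~x) = y~x

  below? : ∀ y → Decidable (λ z → z ∉ I × z ⊑ y)
  below? y z = ¬? (z ∈? I) ×-dec (z ⊑? y)

  -- The 1 in `exchange₁` is absorbed by `y`, which lies below itself.
  dI≤#below : ∀ {y} → y ∉ I → dI y ≤ # (below? y)
  dI≤#below {y} y∉I = ≤-trans (exchange₁ y∉I)
    (#-strict (λ (z∉I , _ , z⊑y , _) → z∉I , z⊑y) (y∉I , ⊑-refl) λ (_ , y≢y , _) → y≢y refl)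

  exchange₂ : ∀ {a b} → a ∉ I → b ∉ I → ¬ a ~ b →
              # (λ x → (x ∈? I) ×-dec ((a ~? x) ⊎-dec (b ~? x))) ≤
              2 + # (λ z → ¬? (z ∈? I) ×-dec ¬? (z ≟ a) ×-dec ¬? (z ≟ b)
                     ×-dec all? (λ x → (z ~? x) →-dec ((x ∈? I) →-dec ((a ~? x) ⊎-dec (b ~? x))))
                     ×-dec ¬? (z ~? a) ×-dec ¬? (z ~? b))
  exchange₂ {a} {b} a∉I b∉I a≁b = begin
    _                     ≤⟨ #-mono ~⇒hit ⟩
    # X.hit?              ≤⟨ X.#hit≤ min ⟩
    # pair? + # X.free?   ≤⟨ +-mono-≤ (≤-trans (#-∪ {Q? = _≟ a} {R? = _≟ b} id)
                                        (+-mono-≤ (#-singleton≤1 a) (#-singleton≤1 b)))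
                               (#-mono λ (z∉I , z≢ , hit , z≁) →
                                  z∉I , z≢ ∘ inj₁ , z≢ ∘ inj₂ , (λ x z~x x∈I → hit⇒~ (hit x z~x x∈I))
                                  , z≁ a (inj₁ refl) , z≁ b (inj₂ refl)) ⟩
    _                     ∎
    where
    open ≤-Reasoning
    pair? : Decidable (λ z → z ≡ a ⊎ z ≡ b)
    pair? z = (z ≟ a) ⊎-dec (z ≟ b)
    pair-ind : ∀ {x z} → x ≡ a ⊎ x ≡ b → z ≡ a ⊎ z ≡ b → ¬ x ~ z
    pair-ind (inj₁ refl) (inj₁ refl) = ~-irr
    pair-ind (inj₁ refl) (inj₂ refl) = a≁b
    pair-ind (inj₂ refl) (inj₁ refl) = a≁b ∘ ~-sym
    pair-ind (inj₂ refl) (inj₂ refl) = ~-irr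
    pair∉I : ∀ {x} → x ≡ a ⊎ x ≡ b → x ∉ I
    pair∉I (inj₁ refl) = a∉I
    pair∉I (inj₂ refl) = b∉I
    module X = Exchange I (proj₁ ids) pair? pair-ind pair∉I
    ~⇒hit : ∀ {x} → x ∈ I × (a ~ x ⊎ b ~ x) → X.Hit x
    ~⇒hit (x∈I , inj₁ a~x) = x∈I , a , inj₁ refl , a~x
    ~⇒hit (x∈I , inj₂ b~x) = x∈I , b , inj₂ refl , b~x
    hit⇒~ : ∀ {x} → X.Hit x → a ~ x ⊎ b ~ x
    hit⇒~ (_ , _ , inj₁ refl , a~x) = inj₁ a~x
    hit⇒~ (_ , _ , inj₂ refl , b~x) = inj₂ b~x

  -- If W can replace its I-neighbours at no cost, the rank cannot grow: a vertex r gaining rank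
  -- is compensated by a vertex losing it.
  module _ {W : Fin n → Set} (W? : Decidable W)
    (W-ind : ∀ {x y} → W x → W y → ¬ x ~ y) (W∉I : ∀ {x} → W x → x ∉ I) where
    open Exchange I (proj₁ ids) W? W-ind W∉I

    opaque
      toggle : (∀ {z} → ¬ Free z) → # W? ≤ # hit? →
               ∀ {r} → Rich r → suc (# (λ x → (r ~? x) ×-dec (kept? x ⊎-dec W? x))) ≡ k → suc (dI r) ≢ k →
               ∃[ z ] Ranked I z × ∃[ x ] z ~ x × (Hit x ⊎ W x)
      toggle ¬free W≤hit {r} rich gain ¬near with exchange
      ... | J , ids-J , ⊆J , classify = loser (any? λ z → ranked? I z ×-dec ¬? (ranked? J z))
        where
        J⊆ : ∀ {x} → x ∈ J → Kept x ⊎ W x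
        J⊆ x∈J with classify x∈J
        ... | inj₁ b = b
        ... | inj₂ f = ⊥-elim (¬free f)

        #J≤ : # (_∈? J) ≤ # (_∈? I)
        #J≤ = begin
          # (_∈? J)          ≤⟨ #-∪ {Q? = W?} {R? = kept?} (Sum.swap ∘ J⊆) ⟩
          # W? + # kept?     ≤⟨ +-monoˡ-≤ _ W≤hit ⟩
          # hit? + # kept?   ≡⟨ ∣I∣≡ ⟨
          # (_∈? I)          ∎
          where open ≤-Reasoning

        ranked-r : Ranked J r
        ranked-r = rich , trans (cong suc (#-cong (λ (r~x , x∈J) → r~x , J⊆ x∈J)
                                                  (λ (r~x , b) → r~x , ⊆J b))) gain

        loser : Dec (∃[ z ] Ranked I z × ¬ Ranked J z) → ∃[ z ] Ranked I z × ∃[ x ] z ~ x × (Hit x ⊎ W x)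
        -- Otherwise all vertices ranked for `I` stay ranked for `J`, and `r` is new, against the
        -- maximality of the rank.
        loser (no ¬loser) = ⊥-elim (<⇒≱
          (#-strict {P? = ranked? I} {Q? = ranked? J}
            (λ {z} ri → decidable-stable (ranked? J z) λ ¬rj → ¬loser (z , ri , ¬rj))
            ranked-r (λ (_ , near) → ¬near near))
          (max J ids-J #J≤))
        loser (yes (z , (rich , near) , ¬rj)) with any? (λ x → (z ~? x) ×-dec (hit? x ⊎-dec W? x))
        ... | yes (x , z~x , h) = z , (rich , near) , x , z~x , h
        -- A vertex with no exchanged neighbour sees the same vertices of `I` and of `J`, so it
        -- keeps its rank.
        ... | no ¬e = ⊥-elim (¬rj (rich , trans (cong suc (#-cong J⇒I I⇒J)) near))
          where
          J⇒I : ∀ {x} → z ~ x × x ∈ J → z ~ x × x ∈ I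
          J⇒I (z~x , x∈J) with J⊆ x∈J
          ... | inj₁ (x∈I , _) = z~x , x∈I
          ... | inj₂ w = ⊥-elim (¬e (_ , z~x , inj₂ w))
          I⇒J : ∀ {x} → z ~ x × x ∈ I → z ~ x × x ∈ J
          I⇒J (z~x , x∈I) = z~x , ⊆J (inj₁ (x∈I , λ h → ¬e (_ , z~x , inj₁ h)))

  -- Good vertices, the discharging rules and the exceptional configurations.

  Class : Fin n → Fin n → Set
  Class u z = z ∉ I × z ⊑ u × u ⊑ z

  class? : ∀ u → Decidable (Class u)
  class? u z = ¬? (z ∈? I) ×-dec (z ⊑? u) ×-dec (u ⊑? z)

  -- The second condition says that the slack is positive. The third bounds `load u`, because the
  -- class of `u` and the full vertices above `u` compete for the k places next to one I-neighbour
  -- of `u`.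
  Good : Fin n → Set
  Good u = u ∉ I × 2 + dI u ≤ k × dI u ≤ # (class? u)

  good? : Decidable Good
  good? u = ¬? (u ∈? I) ×-dec (2 + dI u ≤? k) ×-dec (dI u ≤? # (class? u))

  leaf⇒good : ∀ {u} → u ∉ I → dI u ≡ 1 → Good u
  leaf⇒good u∉I leaf rewrite leaf = u∉I , 3≤k , #-inhabited (u∉I , ⊑-refl , ⊑-refl)

  class⇒≡ : ∀ {u z} → Class u z → dI z ≡ dI u
  class⇒≡ (_ , z⊑u , u⊑z) = ≤-antisym (⊑⇒≤ z⊑u) (⊑⇒≤ u⊑z)

  class-good : ∀ {u z} → Good u → Class u z → Good z
  class-good {u} {z} (_ , 2+d≤k , d≤c) c@(z∉I , z⊑u , u⊑z) rewrite class⇒≡ c =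
    z∉I , 2+d≤k , ≤-trans d≤c (#-mono λ (x∉I , x⊑u , u⊑x) → x∉I , ⊑-trans x⊑u u⊑z , ⊑-trans z⊑u u⊑x)

  opaque
    -- Descend along `⊑` while d drops. At a minimal vertex everything below lies in its class, and
    -- `dI≤#below` makes the class large enough.
    good-below : ∀ {y} → y ∉ I → 2 + dI y ≤ k → ∃[ u ] Good u × u ⊑ y
    good-below {y} = go (dI y) y ≤-refl
      where
      go : ∀ m y → dI y ≤ m → y ∉ I → 2 + dI y ≤ k → ∃[ u ] Good u × u ⊑ y
      go m y ≤m y∉I 2+d≤k with any? (λ z → below? y z ×-dec ¬? (y ⊑? z))
      ... | no ¬e = y , (y∉I , 2+d≤k , ≤-trans (dI≤#below y∉I) (#-mono λ {z} (z∉I , z⊑y) →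
              z∉I , z⊑y , decidable-stable (y ⊑? z) λ y⋢z → ¬e (z , (z∉I , z⊑y) , y⋢z))) , ⊑-refl
      ... | yes (z , (z∉I , z⊑y) , y⋢z) with m | ≤-trans (≰⇒> λ y≤z → y⋢z (⊑∧≥⇒⊒ z⊑y y≤z)) ≤m
      ... | suc m′ | s≤s z≤m′ with go m′ z z≤m′ z∉I (≤-trans (s≤s (s≤s (⊑⇒≤ z⊑y))) 2+d≤k)
      ... | u , good , u⊑z = u , good , ⊑-trans u⊑z z⊑y

  load : Fin n → ℕ
  load u = # (λ v → full? v ×-dec (u ⊑? v))

  payers : Fin n → ℕ
  payers v = # (λ u → good? u ×-dec (u ⊑? v))

  -- The discharging, in half units of slack.  A good u pays 1 to each full v ⊒ u (Base), and 1 more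
  -- if d(u) = 1 and u has at most k - 2 of them (Extra).  If v gets less than 2 in this way, then
  -- either v lies on a K_{k,k} minus an edge va, and a pays 2 (Special), or v has k - 1 twins, whose
  -- neighbourhood is linked to a K_{k-1,k} with an otherwise idle neighbour x, and x pays 1 (Relay).
  -- When d(a) = 1, a ⊑ y says that y is adjacent to the I-neighbour of a.
  Spare : Fin n → Set
  Spare a = k ≤ suc (# (λ y → ¬? (y ∈? I) ×-dec (dI y ≤? 2) ×-dec (a ⊑? y)))

  spare? : Decidable Spare
  spare? a = k ≤? suc (# (λ y → ¬? (y ∈? I) ×-dec (dI y ≤? 2) ×-dec (a ⊑? y)))

  -- The last clause makes the k - 1 neighbours of `a` off `I` one side of the configuration. It
  -- determines `v` as the remaining neighbour of any I-neighbour of theirs, so that `a` pays only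
  -- once.
  Special : Fin n → Fin n → Set
  Special a v = Full v × dI a ≡ 1 × Spare a ×
    (∀ w w′ → a ~ w → w ∉ I → a ~ w′ → w′ ∉ I → suc (dI w) ≡ k × w ⊑ w′ × w ⊑ v)

  opaque
    special? : ∀ a v → Dec (Special a v)
    special? a v = full? v ×-dec (dI a ℕ.≟ 1) ×-dec spare? a ×-dec
      all? λ w → all? λ w′ → (a ~? w) →-dec (¬? (w ∈? I) →-dec ((a ~? w′) →-dec (¬? (w′ ∈? I) →-dec
        ((suc (dI w) ℕ.≟ k) ×-dec (w ⊑? w′) ×-dec (w ⊑? v)))))

  -- In the intended case `r` lies on one side of the K_{k-1,k}, `x` is attached to the other side,
  -- and `u` is the one vertex of that other side that is not in `I`.
  Link : Fin n → Fin n → Set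
  Link x u = u ∉ I × dI u ≡ 1 × ∃[ r ] x ⊑ r × r ≢ x × r ~ u × suc (dI r) ≡ k

  link? : ∀ x u → Dec (Link x u)
  link? x u = ¬? (u ∈? I) ×-dec (dI u ℕ.≟ 1) ×-dec
    any? λ r → (x ⊑? r) ×-dec ¬? (r ≟ x) ×-dec (r ~? u) ×-dec (suc (dI r) ℕ.≟ k)

  -- Uniqueness of `u` bounds the number of receivers of `x` by `load u`, hence by k - 1. The
  -- conditions on `load x` and `Spare x` ensure that `x` pays by no other rule.
  Relay : Fin n → Fin n → Set
  Relay x v = Full v × x ∉ I × dI x ≡ 1 × load x ≡ 0 × ¬ Spare x ×
    ∃[ u ] Link x u × u ⊑ v × (∀ u′ → Link x u′ → u′ ≡ u)

  opaque
    relay? : ∀ x v → Dec (Relay x v)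
    relay? x v = full? v ×-dec ¬? (x ∈? I) ×-dec (dI x ℕ.≟ 1) ×-dec (load x ℕ.≟ 0) ×-dec ¬? (spare? x) ×-dec
      any? λ u → link? x u ×-dec (u ⊑? v) ×-dec all? λ u′ → link? x u′ →-dec (u′ ≟ u)

  -- W and R form a K_{k-1,k-1}, and R and W ∪ {v} a K_{k-1,k}.  Replacing R by W contradicts the choice
  -- of I unless the vertices of W have a common neighbour a outside R.
  module TypeA {v y : Fin n} (full : Full v) (y∉I : y ∉ I) (y-near : suc (dI y) ≡ k)
    (y⊑v : y ⊑ v) (k≤class : k ≤ suc (# (class? y))) (payers≤1 : payers v ≤ 1) where

    W : Fin n → Set
    W = Class y

    R : Fin n → Set
    R x = y ~ x × x ∈ I

    opaque
      r₀-spec : ∃[ r ] R r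
      r₀-spec with dominated y∉I
      ... | r , r∈I , y~r = r , y~r , r∈I
    r₀ = proj₁ r₀-spec
    Rr₀ = proj₂ r₀-spec

    v∉I : v ∉ I
    v∉I = full⇒∉ full

    opaque
      q-spec : ∃[ q ] v ~ q × ¬ R q
      q-spec = #-∃∖ {P? = private-nbr? y} {Q? = v ~?_}
                    (≤-reflexive (trans y-near (sym (reg v))))
    q = proj₁ q-spec
    v~q = proj₁ (proj₂ q-spec)
    q∈I = full⇒∈ full v~q

    y≁q : ¬ y ~ q
    y≁q y~q = proj₂ (proj₂ q-spec) (y~q , q∈I)

    W⇒≁q : ∀ {w} → W w → ¬ w ~ q
    W⇒≁q (_ , w⊑y , _) w~q = y≁q (w⊑y q w~q q∈I)

    v∉W : ¬ W v
    v∉W Wv = W⇒≁q Wv v~q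

    Wy : W y
    Wy = y∉I , ⊑-refl , ⊑-refl

    W~R : ∀ {w r} → W w → R r → w ~ r
    W~R (_ , _ , y⊑w) (y~r , r∈I) = y⊑w _ y~r r∈I

    W~⇒R : ∀ {w x} → W w → w ~ x → x ∈ I → R x
    W~⇒R (_ , w⊑y , _) w~x x∈I = w⊑y _ w~x x∈I , x∈I

    nbr-R : ∀ {r z} → R r → r ~ z → W z ⊎ z ≡ v
    nbr-R Rr@(y~r , r∈I) = almost-all′ _ (class? y) (λ Wz → ~-sym (W~R Wz Rr)) k≤class
                             (~-sym (y⊑v _ y~r r∈I)) v∉W

    #W<k : suc (# (class? y)) ≤ k
    #W<k = ≤-trans (#-strict {Q? = r₀ ~?_} (λ Wz → ~-sym (W~R Wz Rr₀))
                             (~-sym (y⊑v _ (proj₁ Rr₀) (proj₂ Rr₀))) v∉W)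
                   (≤-reflexive (reg r₀))

    W-near : ∀ {w} → W w → suc (dI w) ≡ k
    W-near Ww = trans (cong suc (class⇒≡ Ww)) y-near

    -- `exchange₁` at `w` asks for k - 2 vertices below `w` that are not adjacent to it. All
    -- candidates lie in W without `w`, which has at most k - 2 elements, so each of these
    -- qualifies.
    W-ind : ∀ {w w′} → W w → W w′ → ¬ w ~ w′
    W-ind {w} {w′} Ww@(w∉I , w⊑y , y⊑w) Ww′ w~w′ with w′ ≟ w
    ... | yes refl = ~-irr w~w′
    ... | no w′≢w = proj₂ (proj₂ (proj₂ (#-⊇ {Q? = rest?} Z⊆rest count (Ww′ , w′≢w)))) (~-sym w~w′)
      where
      rest? : Decidable (λ z → W z × z ≢ w)
      rest? z = class? y z ×-dec ¬? (z ≟ w)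
      Z⊆rest : ∀ {z} → z ∉ I × z ≢ w × z ⊑ w × ¬ z ~ w → W z × z ≢ w
      Z⊆rest (z∉I , z≢w , z⊑w , _) with dominated z∉I
      ... | x , x∈I , z~x with nbr-R (W~⇒R Ww (z⊑w _ z~x x∈I) x∈I) (~-sym z~x)
      ... | inj₁ Wz = Wz , z≢w
      ... | inj₂ refl = ⊥-elim (W⇒≁q Ww (z⊑w q v~q q∈I))
      count : # rest? ≤ _
      count = ≤-pred (≤-pred (begin
        2 + # rest?       ≡⟨ cong suc (#-remove Ww) ⟨
        suc (# (class? y)) ≤⟨ #W<k ⟩
        k                 ≡⟨ W-near Ww ⟨
        suc (dI w)        ≤⟨ s≤s (exchange₁ w∉I) ⟩
        _                 ∎))
        where open ≤-Reasoning

    open Exchange I (proj₁ ids) (class? y) W-ind proj₁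

    hit⇒R : ∀ {x} → Hit x → R x
    hit⇒R (x∈I , _ , Ww , w~x) = W~⇒R Ww w~x x∈I

    opaque
      toggled : ∃[ z ] Ranked I z × ∃[ x ] z ~ x × (Hit x ⊎ W x)
      toggled = toggle (class? y) W-ind proj₁ ¬free #W≤#hit {r₀} rich gain ¬near
        where
        ¬free : ∀ {z} → ¬ Free z
        ¬free (z∉I , ¬Wz , hit , _) with dominated z∉I
        ... | x , x∈I , z~x with nbr-R (hit⇒R (hit x z~x x∈I)) (~-sym z~x)
        ... | inj₁ Wz = ¬Wz Wz
        ... | inj₂ refl = y≁q (proj₁ (hit⇒R (hit q v~q q∈I)))
        #W≤#hit : # (class? y) ≤ # hit?
        #W≤#hit = ≤-pred (≤-trans #W<k (≤-trans (≤-reflexive (sym y-near))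
                    (s≤s (#-mono λ (y~x , x∈I) → x∈I , y , Wy , y~x))))
        rich : Rich r₀
        rich = ≤-trans (≤-reflexive (sym y-near)) (s≤s (#-mono {P? = private-nbr? y} λ Rr z r₀~z →
          [ (λ Wz → ~-sym (W~R Wz Rr)) , (λ { refl → ~-sym (y⊑v _ (proj₁ Rr) (proj₂ Rr)) }) ]
            (nbr-R Rr₀ r₀~z)))
        gain : suc (# (λ x → (r₀ ~? x) ×-dec (kept? x ⊎-dec class? y x))) ≡ k
        gain = trans (cong suc (#-cong {Q? = class? y}
          (λ { (r₀~x , inj₁ (x∈I , _)) → ⊥-elim (ind (proj₂ Rr₀) x∈I r₀~x) ; (_ , inj₂ Wx) → Wx })
          (λ Wx → ~-sym (W~R Wx Rr₀) , inj₂ Wx))) (≤-antisym #W<k k≤class)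
        ¬near : suc (dI r₀) ≢ k
        ¬near near = <⇒≱ 2≤k (≤-trans (≤-reflexive (sym near))
                                      (s≤s (≤-reflexive (∈⇒dI≡0 (proj₂ Rr₀)))))

    -- The twins of a rich z ∈ W exhaust W.
    opaque
      common-nbr′ : ∀ {z} → W z → Rich z → ∃[ a ] a ∉ I × (∀ {w} → W w → w ~ a)
      common-nbr′ {z} Wz rich with #-∃∖ {P? = private-nbr? z} {Q? = z ~?_}
                                        (≤-reflexive (trans (W-near Wz) (sym (reg z))))
      ... | a , z~a , ¬a∈I = a , (λ a∈I → ¬a∈I (z~a , a∈I)) , λ Ww → W⊆twin Ww a z~a
        where
        twin⊆W : ∀ {t} → Twin z t → W t
        twin⊆W tw with nbr-R Rr₀ (~-sym (tw r₀ (W~R Wz Rr₀)))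
        ... | inj₁ Wt = Wt
        ... | inj₂ refl = ⊥-elim (W⇒≁q Wz (twin-sym reg tw q v~q))
        W⊆twin : ∀ {w} → W w → Twin z w
        W⊆twin = #-⊇ {P? = twin? z} twin⊆W (≤-pred (≤-trans #W<k rich))

    opaque
      common-nbr : ∃[ a ] a ∉ I × (∀ {w} → W w → w ~ a)
      common-nbr with toggled
      ... | z , (rich , z-near) , x , z~x , inj₁ h with nbr-R (hit⇒R h) (~-sym z~x)
      ...   | inj₁ Wz = common-nbr′ Wz rich
      ...   | inj₂ refl = ⊥-elim (proj₂ (near z-near) full)
      -- Here `x` would have k + 1 neighbours: the k - 1 vertices of R, `z`, and a second twin `z′`
      -- of `z`. The twin is not in R, since it shares with `z` a neighbour in `I`.
      common-nbr | z , (rich , z-near) , x , z~x , inj₂ Wx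
        with #-∃∖ {P? = _≟ z} {Q? = twin? z} (≤-trans (s≤s (#-singleton≤1 z))
                  (≤-pred (≤-trans 3≤k rich)))
      ... | z′ , tw , z′≢z with private-nbr? y z′
      ...   | yes Rz′ = ⊥-elim (twin∉R Rz′ (dominated (proj₁ (near z-near))))
        where
        twin∉R : R z′ → ¬ (∃[ x₀ ] x₀ ∈ I × z ~ x₀)
        twin∉R Rz′ (x₀ , x₀∈I , z~x₀) = ind x₀∈I (proj₂ Rz′) (~-sym (tw x₀ z~x₀))
      ...   | no ¬Rz′ = ⊥-elim (z′≢z (almost-all x (private-nbr? y) (W~R Wx)
                (≤-reflexive (sym y-near)) (~-sym (tw x z~x)) (~-sym z~x) ¬Rz′
                (λ Rz → proj₁ (near z-near) (proj₂ Rz))))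

    -- R with `a`, and W with `v`, are the sides of a K_{k,k} without the edge va.
    special : ∃[ a ] Special a v
    special with common-nbr
    ... | a , a∉I , W~a with dominated a∉I
    ... | a′ , a′∈I , a~a′ = a , full , leaf , spare , λ w w′ a~w w∉I a~w′ w′∉I →
      W-near (a~⇒W a~w w∉I) , ⊑-trans (proj₁ (proj₂ (a~⇒W a~w w∉I))) (proj₂ (proj₂ (a~⇒W a~w′ w′∉I)))
      , ⊑-trans (proj₁ (proj₂ (a~⇒W a~w w∉I))) y⊑v
      where
      nbr-a : ∀ {x} → a ~ x → W x ⊎ x ≡ a′
      nbr-a = almost-all′ a (class? y) (~-sym ∘ W~a) k≤class a~a′ λ Wa′ → proj₁ Wa′ a′∈I

      a~⇒W : ∀ {w} → a ~ w → w ∉ I → W w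
      a~⇒W a~w w∉I with nbr-a a~w
      ... | inj₁ Ww = Ww
      ... | inj₂ refl = ⊥-elim (w∉I a′∈I)

      a~⇒≡a′ : ∀ {x} → a ~ x → x ∈ I → x ≡ a′
      a~⇒≡a′ a~x x∈I with nbr-a a~x
      ... | inj₁ Wx = ⊥-elim (proj₁ Wx x∈I)
      ... | inj₂ x≡a′ = x≡a′

      leaf : dI a ≡ 1
      leaf = unique⇒leaf a∉I a~⇒≡a′

      a≁v : ¬ a ~ v
      a≁v a~v = a∉I (full⇒∈ full (~-sym a~v))

      nbr-v : ∀ {x} → v ~ x → R x ⊎ x ≡ q
      nbr-v = almost-all′ v (private-nbr? y) (λ (y~r , r∈I) → y⊑v _ y~r r∈I)
                (≤-reflexive (sym y-near)) v~q (proj₂ (proj₂ q-spec))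

      H? : Decidable (λ x → x ∈ I × (a ~ x ⊎ v ~ x))
      H? x = (x ∈? I) ×-dec ((a ~? x) ⊎-dec (v ~? x))

      Z? : Decidable (λ z → z ∉ I × z ≢ a × z ≢ v ×
                           (∀ x → z ~ x → x ∈ I → a ~ x ⊎ v ~ x) × ¬ z ~ a × ¬ z ~ v)
      Z? z = ¬? (z ∈? I) ×-dec ¬? (z ≟ a) ×-dec ¬? (z ≟ v)
             ×-dec all? (λ x → (z ~? x) →-dec ((x ∈? I) →-dec ((a ~? x) ⊎-dec (v ~? x))))
             ×-dec ¬? (z ~? a) ×-dec ¬? (z ~? v)

      #H≤ : # H? ≤ 2 + # Z?
      #H≤ = exchange₂ a∉I v∉I a≁v

      N-v⊆H : ∀ {x} → v ~ x → x ∈ I × (a ~ x ⊎ v ~ x)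
      N-v⊆H v~x = full⇒∈ full v~x , inj₂ v~x

      Z~⇒ : ∀ {z x} → z ∉ I × z ≢ a × z ≢ v × (∀ x → z ~ x → x ∈ I → a ~ x ⊎ v ~ x) × ¬ z ~ a × ¬ z ~ v →
            z ~ x → x ∈ I → x ≡ a′ ⊎ x ≡ q
      Z~⇒ {z} {x} (_ , _ , z≢v , closed , z≁a , _) z~x x∈I with closed x z~x x∈I
      ... | inj₁ a~x = inj₁ (a~⇒≡a′ a~x x∈I)
      ... | inj₂ v~x with nbr-v v~x
      ...   | inj₂ x≡q = inj₂ x≡q
      ...   | inj₁ Rx with nbr-R Rx (~-sym z~x)
      ...     | inj₁ Wz = ⊥-elim (z≁a (W~a Wz))
      ...     | inj₂ z≡v = ⊥-elim (z≢v z≡v)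

      q-leaf⇒payer : ∀ {z} → z ∉ I → (∀ {x} → z ~ x → x ∈ I → x ≡ q) → Good z × z ⊑ v
      q-leaf⇒payer z∉I only-q = leaf⇒good z∉I (unique⇒leaf z∉I only-q)
        , λ x z~x x∈I → subst (v ~_) (sym (only-q z~x x∈I)) v~q

      -- Exchange with {a, v}: the vertices left undominated see only `a′` and `q` in `I`. Those
      -- that see `q` alone are payers of `v`, so there is at most one; the others count for
      -- `Spare a`, and so does `a`.
      spare : Spare a
      spare with a′ ≟ q
      -- If `a′` is `q`, all the undominated vertices are payers of `v`, and there are at least k -
      -- 2 of them.
      ... | yes refl = ⊥-elim (<⇒≱ 4≤k (begin
        k                ≡⟨ reg v ⟨
        # (v ~?_)        ≤⟨ #-mono N-v⊆H ⟩
        # H?             ≤⟨ #H≤ ⟩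
        2 + # Z?         ≤⟨ +-monoʳ-≤ 2 (#-mono λ Zz → q-leaf⇒payer (proj₁ Zz) λ z~x x∈I →
                              [ id , id ] (Z~⇒ Zz z~x x∈I)) ⟩
        2 + payers v     ≤⟨ +-monoʳ-≤ 2 payers≤1 ⟩
        3                ∎))
        where open ≤-Reasoning
      ... | no a′≢q = ≤-pred (begin
        suc k             ≡⟨ cong suc (reg v) ⟨
        suc (# (v ~?_))   ≤⟨ #-strict N-v⊆H (a′∈I , inj₁ a~a′) v≁a′ ⟩
        # H?              ≤⟨ #H≤ ⟩
        2 + # Z?          ≤⟨ +-monoʳ-≤ 2 (#-∪ {Q? = S≢a?} {R? = λ u → good? u ×-dec (u ⊑? v)} split) ⟩
        2 + (# S≢a? + payers v)  ≤⟨ +-monoʳ-≤ 2 (+-monoʳ-≤ _ payers≤1) ⟩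
        2 + (# S≢a? + 1)  ≡⟨ cong (2 +_) (+-comm _ 1) ⟩
        3 + # S≢a?        ≡⟨ cong (2 +_) (#-remove {P? = S?} (a∉I , ≤-trans (≤-reflexive leaf) (n≤1+n 1) , ⊑-refl)) ⟨
        2 + # S?          ∎)
        where
        open ≤-Reasoning
        S? : Decidable (λ z → z ∉ I × dI z ≤ 2 × a ⊑ z)
        S? z = ¬? (z ∈? I) ×-dec (dI z ≤? 2) ×-dec (a ⊑? z)
        S≢a? : Decidable (λ z → (z ∉ I × dI z ≤ 2 × a ⊑ z) × z ≢ a)
        S≢a? z = S? z ×-dec ¬? (z ≟ a)
        v≁a′ : ¬ v ~ a′
        v≁a′ v~a′ with nbr-v v~a′
        ... | inj₂ a′≡q = a′≢q a′≡q
        ... | inj₁ Ra′ with nbr-R Ra′ (~-sym a~a′)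
        ...   | inj₁ Wa = W-ind Wy Wa (W~a Wy)
        ...   | inj₂ refl = a≁v (⊥-elim (proj₁ (near y-near) (full⇒∈ full (~-sym (W~a Wy)))))
        split : ∀ {z} → _ → ((z ∉ I × dI z ≤ 2 × a ⊑ z) × z ≢ a) ⊎ (Good z × z ⊑ v)
        split {z} Zz@(z∉I , z≢a , _) with z ~? a′
        ... | yes z~a′ = inj₁ ((z∉I
            , ≤-trans (#-∪ {Q? = _≟ a′} {R? = _≟ q} λ (z~x , x∈I) → Z~⇒ Zz z~x x∈I)
                      (+-mono-≤ (#-singleton≤1 a′) (#-singleton≤1 q))
            , leaf⊑ leaf a~a′ a′∈I z~a′) , z≢a)
        ... | no z≁a′ = inj₂ (q-leaf⇒payer z∉I only-q)
          where
          only-q : ∀ {x} → z ~ x → x ∈ I → x ≡ q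
          only-q z~x x∈I with Z~⇒ Zz z~x x∈I
          ... | inj₁ refl = ⊥-elim (z≁a′ z~x)
          ... | inj₂ x≡q = x≡q

  -- N(v) and the twins R₁ of v form a K_{k,k-1}, and u is its only private neighbour, adjacent to
  -- q ∈ N(v).  Replacing q by u contradicts the choice of I unless u lies on a second K_{k-1,k}, with
  -- sides R₂ and W₂ ∪ {u}; replacing N(v) ∪ W₂ by R₁ ∪ R₂ then exposes x.
  module TypeB {v u : Fin n} (full : Full v) (u-good : Good u) (leaf : dI u ≡ 1) (u⊑v : u ⊑ v)
    (k≤twins : Rich v) (crowded : ∀ {z} → u ⊑ z → Full z ⊎ z ≡ u) (payers≤1 : payers v ≤ 1) where

    u∉I : u ∉ I
    u∉I = proj₁ u-good

    R₁ : Fin n → Set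
    R₁ = Twin v

    v∉I : v ∉ I
    v∉I = full⇒∉ full

    R₁-full : ∀ {z} → R₁ z → Full z
    R₁-full {z} tw = trans (#-cong {Q? = z ~?_} proj₁ λ z~x → z~x , full⇒∈ full (twin-sym reg tw _ z~x))
                           (reg z)

    leaf≢k : dI u ≢ k
    leaf≢k full-u = <⇒≱ 2≤k (≤-trans (≤-reflexive (sym full-u)) (≤-reflexive leaf))

    u∉R₁ : ¬ R₁ u
    u∉R₁ tw = leaf≢k (R₁-full tw)

    opaque
      q-spec : ∃[ q ] q ∈ I × u ~ q
      q-spec = dominated u∉I
    q = proj₁ q-spec
    q∈I = proj₁ (proj₂ q-spec)
    u~q = proj₂ (proj₂ q-spec)

    v~q : v ~ q
    v~q = u⊑v q u~q q∈I

    u~⇒≡q : ∀ {x} → u ~ x → x ∈ I → x ≡ q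
    u~⇒≡q u~x x∈I = leaf-unique leaf u~x x∈I u~q q∈I

    nbr-q : ∀ {z} → q ~ z → R₁ z ⊎ z ≡ u
    nbr-q = almost-all′ q (twin? v) (λ tw → ~-sym (tw q v~q)) k≤twins (~-sym u~q) u∉R₁

    nbr-U₁ : ∀ {s x} → v ~ s → s ~ x → ¬ R₁ x → ∀ {z} → s ~ z → R₁ z ⊎ z ≡ x
    nbr-U₁ {s} v~s s~x ¬Rx = almost-all′ s (twin? v) (λ tw → ~-sym (tw s v~s)) k≤twins s~x ¬Rx

    module U where
      W-ind : ∀ {x y} → x ≡ u → y ≡ u → ¬ x ~ y
      W-ind refl refl = ~-irr
      W∉I : ∀ {x} → x ≡ u → x ∉ I
      W∉I refl = u∉I
      open Exchange I (proj₁ ids) (_≟ u) W-ind W∉I public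

    hit⇒≡q : ∀ {x} → U.Hit x → x ≡ q
    hit⇒≡q (x∈I , _ , refl , u~x) = u~⇒≡q u~x x∈I

    opaque
      -- Exchanging `q` for `u` takes the full vertex `v` down to k - 1 neighbours in the set, so
      -- `v` gains rank.
      toggled : ∃[ z ] Ranked I z × ∃[ x ] z ~ x × (U.Hit x ⊎ x ≡ u)
      toggled = toggle (_≟ u) U.W-ind U.W∉I ¬free
                  (≤-trans (#-singleton≤1 u) (#-inhabited (q∈I , u , refl , u~q))) {v} k≤twins gain
                  (λ v-near → proj₂ (near v-near) full)
        where
        ¬free : ∀ {z} → ¬ U.Free z
        ¬free {z} (z∉I , z≢u , hit , _) with dominated z∉I
        ... | x , x∈I , z~x with hit⇒≡q (hit x z~x x∈I)
        ... | refl with nbr-q (~-sym z~x)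
        ... | inj₂ z≡u = z≢u z≡u
        ... | inj₁ Rz = <⇒≱ 2≤k (≤-trans (≤-reflexive (sym (R₁-full Rz)))
                (≤-reflexive (unique⇒leaf z∉I λ z~x x∈I → hit⇒≡q (hit _ z~x x∈I))))
        gain : suc (# (λ x → (v ~? x) ×-dec (U.kept? x ⊎-dec (x ≟ u)))) ≡ k
        gain = trans (cong suc (#-cong {Q? = λ x → (v ~? x) ×-dec ¬? (x ≟ q)} to from))
                     (trans (sym (#-remove v~q)) (reg v))
          where
          to : ∀ {x} → v ~ x × (U.Kept x ⊎ x ≡ u) → v ~ x × x ≢ q
          to (v~x , inj₁ (_ , ¬hit)) = v~x , λ { refl → ¬hit (q∈I , u , refl , u~q) }
          to (v~x , inj₂ refl) = ⊥-elim (u∉I (full⇒∈ full v~x))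
          from : ∀ {x} → v ~ x × x ≢ q → v ~ x × (U.Kept x ⊎ x ≡ u)
          from (v~x , x≢q) = v~x , inj₁ (full⇒∈ full v~x , λ h → x≢q (hit⇒≡q h))

    opaque
      partner : ∃[ y ] Ranked I y × y ~ u
      partner with toggled
      ... | y , ranked , x , y~x , inj₂ refl = y , ranked , y~x
      ... | y , (rich , y-near) , x , y~x , inj₁ h with hit⇒≡q h
      ...   | refl with nbr-q (~-sym y~x)
      ...     | inj₁ Ry = ⊥-elim (proj₂ (near y-near) (R₁-full Ry))
      ...     | inj₂ refl = ⊥-elim (<⇒≱ 3≤k (≤-trans (≤-reflexive (sym y-near)) (s≤s (≤-reflexive leaf))))

    y₂ = proj₁ partner
    rich₂ = proj₁ (proj₁ (proj₂ partner))
    near₂ = proj₂ (proj₁ (proj₂ partner))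
    y₂~u = proj₂ (proj₂ partner)

    R₂ : Fin n → Set
    R₂ = Twin y₂

    R₂-near : ∀ {z} → R₂ z → suc (dI z) ≡ k
    R₂-near {z} tw = trans (cong suc (#-cong
      (λ (z~x , x∈I) → twin-sym reg tw _ z~x , x∈I) (λ (y~x , x∈I) → tw _ y~x , x∈I))) near₂

    R₂∉I : ∀ {z} → R₂ z → z ∉ I
    R₂∉I tw = proj₁ (near (R₂-near tw))

    R₁∩R₂ : ∀ {z} → R₁ z → ¬ R₂ z
    R₁∩R₂ tw₁ tw₂ = proj₂ (near (R₂-near tw₂)) (R₁-full tw₁)

    W₂ : Fin n → Set
    W₂ s = y₂ ~ s × s ∈ I

    nbr-W₂ : ∀ {s x} → y₂ ~ s → s ~ x → ¬ R₂ x → ∀ {z} → s ~ z → R₂ z ⊎ z ≡ x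
    nbr-W₂ {s} y~s s~x ¬Rx = almost-all′ s (twin? y₂) (λ tw → ~-sym (tw s y~s)) rich₂ s~x ¬Rx

    nbr-y₂ : ∀ {x} → y₂ ~ x → W₂ x ⊎ x ≡ u
    nbr-y₂ = almost-all′ y₂ (private-nbr? y₂) proj₁ (≤-reflexive (sym near₂)) y₂~u λ (_ , u∈I) → u∉I u∈I

    nbr-u : ∀ {x} → u ~ x → R₂ x ⊎ x ≡ q
    nbr-u = nbr-W₂ y₂~u u~q λ tw → R₂∉I tw q∈I

    2k-2≰k : ∀ {a b} → k ≤ suc a → k ≤ suc b → ¬ a + b ≤ k
    2k-2≰k {a} {b} k≤a k≤b a+b≤k = <⇒≱ 3≤k (+-cancelʳ-≤ k k 2 (begin
      k + k          ≤⟨ +-mono-≤ k≤a k≤b ⟩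
      suc a + suc b  ≡⟨ cong suc (+-suc a b) ⟩
      2 + (a + b)    ≤⟨ +-monoʳ-≤ 2 a+b≤k ⟩
      2 + k          ∎))
      where open ≤-Reasoning

    U₁∩W₂ : ∀ {s} → v ~ s → ¬ W₂ s
    U₁∩W₂ {s} v~s (y~s , _) = 2k-2≰k k≤twins rich₂ (≤-trans
      (#-⊎ {R? = s ~?_} (λ tw → ~-sym (tw s v~s)) (λ tw → ~-sym (tw s y~s)) R₁∩R₂)
      (≤-reflexive (reg s)))

    module B where
      W? : Decidable (λ z → R₁ z ⊎ R₂ z)
      W? z = twin? v z ⊎-dec twin? y₂ z
      W-ind : ∀ {x y} → R₁ x ⊎ R₂ x → R₁ y ⊎ R₂ y → ¬ x ~ y
      W-ind (inj₁ tx) (inj₁ ty) x~y = full⇒∉ (R₁-full ty) (full⇒∈ (R₁-full tx) x~y)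
      W-ind (inj₁ tx) (inj₂ ty) x~y = R₂∉I ty (full⇒∈ (R₁-full tx) x~y)
      W-ind (inj₂ tx) (inj₁ ty) x~y = R₂∉I tx (full⇒∈ (R₁-full ty) (~-sym x~y))
      W-ind (inj₂ tx) (inj₂ ty) x~y = ~-irr (ty _ (twin-sym reg tx _ x~y))
      W∉I : ∀ {x} → R₁ x ⊎ R₂ x → x ∉ I
      W∉I (inj₁ tx) = full⇒∉ (R₁-full tx)
      W∉I (inj₂ tx) = R₂∉I tx
      open Exchange I (proj₁ ids) W? W-ind W∉I public

    hit⇒U₁∪W₂ : ∀ {s} → B.Hit s → v ~ s ⊎ W₂ s
    hit⇒U₁∪W₂ (s∈I , r , inj₁ tw , r~s) = inj₁ (twin-sym reg tw _ r~s)
    hit⇒U₁∪W₂ (s∈I , r , inj₂ tw , r~s) = inj₂ (twin-sym reg tw _ r~s , s∈I)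

    opaque
      -- The exchange hits the k vertices of N(v) and the k - 1 of W₂, while R₁ and R₂ have at most
      -- k - 1 elements each.
      1≤#free : 1 ≤ # B.free?
      1≤#free = +-cancelˡ-≤ (# (twin? v) + # (twin? y₂)) _ _ (≤-pred (begin
        suc (# (twin? v) + # (twin? y₂) + 1)        ≡⟨ cong suc (+-assoc (# (twin? v)) _ 1) ⟩
        suc (# (twin? v)) + (# (twin? y₂) + 1)      ≤⟨ +-mono-≤ (#twin<k v) (≤-trans (≤-reflexive (+-comm _ 1)) (#twin<k y₂)) ⟩
        k + k                                       ≡⟨ cong (k +_) near₂ ⟨
        k + suc (dI y₂)                             ≡⟨ +-suc k _ ⟩
        suc (k + dI y₂)                             ≡⟨ cong (λ m → suc (m + dI y₂)) (reg v) ⟨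
        suc (# (v ~?_) + dI y₂)                     ≤⟨ s≤s (#-⊎ {R? = B.hit?}
                                                        (λ v~s → full⇒∈ full v~s , v , inj₁ (λ _ → id) , v~s)
                                                        (λ (y~s , s∈I) → s∈I , y₂ , inj₂ (λ _ → id) , y~s) U₁∩W₂) ⟩
        suc (# B.hit?)                              ≤⟨ s≤s (B.#hit≤ min) ⟩
        suc (# B.W? + # B.free?)                    ≤⟨ s≤s (+-monoˡ-≤ _ (#-∪ {Q? = twin? v} {R? = twin? y₂} id)) ⟩
        suc (# (twin? v) + # (twin? y₂) + # B.free?) ∎))
        where open ≤-Reasoning

    opaque
      x-spec : ∃ B.Free
      x-spec = #-∃ {P? = B.free?} 1≤#free
    x = proj₁ x-spec

    x∉I : x ∉ I
    x∉I = proj₁ (proj₂ x-spec)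

    ¬R₁x : ¬ R₁ x
    ¬R₁x tw = proj₁ (proj₂ (proj₂ x-spec)) (inj₁ tw)

    ¬R₂x : ¬ R₂ x
    ¬R₂x tw = proj₁ (proj₂ (proj₂ x-spec)) (inj₂ tw)

    x~⇒ : ∀ {s} → x ~ s → s ∈ I → v ~ s ⊎ W₂ s
    x~⇒ x~s s∈I = hit⇒U₁∪W₂ (proj₁ (proj₂ (proj₂ (proj₂ x-spec))) _ x~s s∈I)

    x≢u : x ≢ u
    x≢u x≡u = proj₂ (proj₂ (proj₂ (proj₂ x-spec))) y₂ (inj₂ λ _ → id) (subst (_~ y₂) (sym x≡u) (~-sym y₂~u))

    common⇒R : ∀ {z s} → x ~ s → s ∈ I → z ~ s → z ≢ x → (v ~ s × R₁ z) ⊎ (W₂ s × R₂ z)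
    common⇒R x~s s∈I z~s z≢x with x~⇒ x~s s∈I
    ... | inj₁ v~s with nbr-U₁ v~s (~-sym x~s) ¬R₁x (~-sym z~s)
    ...   | inj₁ Rz = inj₁ (v~s , Rz)
    ...   | inj₂ z≡x = ⊥-elim (z≢x z≡x)
    common⇒R x~s s∈I z~s z≢x | inj₂ W₂s with nbr-W₂ (proj₁ W₂s) (~-sym x~s) ¬R₂x (~-sym z~s)
    ...   | inj₁ Rz = inj₂ (W₂s , Rz)
    ...   | inj₂ z≡x = ⊥-elim (z≢x z≡x)

    opaque
      -- Otherwise exchange with {u, x}: W₂ and `q` are hit, at least k ≥ 3 vertices, so some `z` is
      -- left undominated. In R₂ it would be adjacent to `u`; in R₁ it would force both N(v) without
      -- `q` and W₂ into N(x), that is 2k - 2 vertices.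
      W₂⊈x : ¬ (∀ {s} → W₂ s → x ~ s)
      W₂⊈x W₂⊆x with #-∃ {P? = Z?} 1≤#Z
        where
        u≁x : ¬ u ~ x
        u≁x u~x with nbr-u u~x
        ... | inj₁ R₂x = ¬R₂x R₂x
        ... | inj₂ x≡q = x∉I (subst (_∈ I) (sym x≡q) q∈I)
        Z? : Decidable (λ z → z ∉ I × z ≢ u × z ≢ x ×
                             (∀ s → z ~ s → s ∈ I → u ~ s ⊎ x ~ s) × ¬ z ~ u × ¬ z ~ x)
        Z? z = ¬? (z ∈? I) ×-dec ¬? (z ≟ u) ×-dec ¬? (z ≟ x)
               ×-dec all? (λ s → (z ~? s) →-dec ((s ∈? I) →-dec ((u ~? s) ⊎-dec (x ~? s))))
               ×-dec ¬? (z ~? u) ×-dec ¬? (z ~? x)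
        1≤#Z : 1 ≤ # Z?
        1≤#Z = +-cancelˡ-≤ 2 _ _ (≤-trans 3≤k (begin
          k                     ≡⟨ near₂ ⟨
          suc (dI y₂)           ≤⟨ #-strict (λ W₂s → proj₂ W₂s , inj₂ (W₂⊆x W₂s)) (q∈I , inj₁ u~q) (U₁∩W₂ v~q) ⟩
          _                     ≤⟨ exchange₂ u∉I x∉I u≁x ⟩
          2 + # Z?              ∎))
          where open ≤-Reasoning
      ... | z , z∉I , z≢u , z≢x , closed , z≁u , _ = contra (dominated z∉I)
        where
        R₁z-absurd : ¬ R₁ z
        R₁z-absurd R₁z = 2k-2≰k (≤-reflexive (trans (sym (reg v)) (#-remove {P? = v ~?_} v~q))) (≤-reflexive (sym near₂))
          (≤-trans (#-⊎ {P? = λ s → (v ~? s) ×-dec ¬? (s ≟ q)} {Q? = private-nbr? y₂} {R? = x ~?_}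
                        U₁⊆x W₂⊆x (λ (v~s , _) → U₁∩W₂ v~s))
                   (≤-reflexive (reg x)))
          where
          U₁⊆x : ∀ {s} → v ~ s × s ≢ q → x ~ s
          U₁⊆x (v~s , s≢q) with closed _ (R₁z _ v~s) (full⇒∈ full v~s)
          ... | inj₁ u~s = ⊥-elim (s≢q (u~⇒≡q u~s (full⇒∈ full v~s)))
          ... | inj₂ x~s = x~s
        contra : ∃[ s ] s ∈ I × z ~ s → ⊥
        contra (s , s∈I , z~s) with closed s z~s s∈I
        ... | inj₁ u~s with u~⇒≡q u~s s∈I
        ...   | refl with nbr-q (~-sym z~s)
        ...     | inj₁ R₁z = R₁z-absurd R₁z
        ...     | inj₂ z≡u = z≢u z≡u
        contra (s , s∈I , z~s) | inj₂ x~s with common⇒R x~s s∈I z~s z≢x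
        ... | inj₁ (_ , R₁z) = R₁z-absurd R₁z
        ... | inj₂ (_ , R₂z) = z≁u (R₂z _ y₂~u)

    below-x : ∀ {z} → z ∉ I × z ⊑ x → z ≡ x
    below-x {z} (z∉I , z⊑x) with z ≟ x
    ... | yes z≡x = z≡x
    ... | no z≢x with dominated z∉I
    ...   | s , s∈I , z~s with common⇒R (z⊑x s z~s s∈I) s∈I z~s z≢x
    ...     | inj₂ (_ , R₂z) = ⊥-elim (W₂⊈x λ (y~s , s∈I) → z⊑x _ (R₂z _ y~s) s∈I)
    ...     | inj₁ (_ , R₁z) with nbr-q (~-sym (z⊑x q (R₁z _ v~q) q∈I))
    ...       | inj₁ R₁x = ⊥-elim (¬R₁x R₁x)
    ...       | inj₂ x≡u = ⊥-elim (x≢u x≡u)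

    -- Nothing but `x` lies below `x`, so already the exchange with {x} bounds d(x) by 1.
    x-leaf : dI x ≡ 1
    x-leaf = ≤-antisym (≤-trans (dI≤#below x∉I)
      (#-unique λ Pz Pz′ → trans (below-x Pz) (sym (below-x Pz′)))) (∉⇒1≤dI x∉I)

    relayed : ∃[ x ] Relay x v
    relayed with dominated x∉I
    ... | s , s∈I , x~s with x~⇒ x~s s∈I
    -- In this case `x` would be a second payer of `v`, besides `u`.
    ...   | inj₁ v~s = ⊥-elim (<⇒≱ (#-pair {P? = λ z → good? z ×-dec (z ⊑? v)}
              (leaf⇒good x∉I x-leaf , leaf⊑ x-leaf x~s s∈I v~s) (u-good , u⊑v) x≢u) payers≤1)
    ...   | inj₂ W₂s@(y₂~s , _) = x , full , x∉I , x-leaf , #-empty ¬loaded , ¬spare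
            , u , (u∉I , leaf , y₂ , leaf⊑ x-leaf x~s s∈I y₂~s , y₂≢x , y₂~u , near₂) , u⊑v , only-u
      where
      y₂≢x : y₂ ≢ x
      y₂≢x y₂≡x = ¬R₂x (subst R₂ y₂≡x λ _ → id)
      x⊑⇒ : ∀ {z} → x ⊑ z → R₂ z ⊎ z ≡ x
      x⊑⇒ x⊑z = nbr-W₂ y₂~s (~-sym x~s) ¬R₂x (~-sym (x⊑z s x~s s∈I))
      ¬loaded : ∀ {z} → ¬ (Full z × x ⊑ z)
      ¬loaded (full-z , x⊑z) with x⊑⇒ x⊑z
      ... | inj₁ R₂z = proj₂ (near (R₂-near R₂z)) full-z
      ... | inj₂ refl = <⇒≱ 2≤k (≤-trans (≤-reflexive (sym full-z)) (≤-reflexive x-leaf))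
      ¬spare : ¬ Spare x
      ¬spare k≤ = <⇒≱ 3≤k (≤-trans k≤ (s≤s (≤-trans (#-mono only-x) (#-singleton≤1 x))))
        where
        only-x : ∀ {z} → z ∉ I × dI z ≤ 2 × x ⊑ z → z ≡ x
        only-x (_ , ≤2 , x⊑z) with x⊑⇒ x⊑z
        ... | inj₁ R₂z = ⊥-elim (<⇒≱ 4≤k (≤-trans (≤-reflexive (sym (R₂-near R₂z))) (s≤s ≤2)))
        ... | inj₂ z≡x = z≡x
      only-u : ∀ u′ → Link x u′ → u′ ≡ u
      only-u u′ (u′∉I , _ , r , x⊑r , r≢x , r~u′ , _) with x⊑⇒ x⊑r
      ... | inj₂ r≡x = ⊥-elim (r≢x r≡x)
      ... | inj₁ R₂r with nbr-y₂ (twin-sym reg R₂r _ r~u′)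
      ...   | inj₁ (_ , u′∈I) = ⊥-elim (u′∉I u′∈I)
      ...   | inj₂ u′≡u = u′≡u

  -- The accounts of the discharging.

  Base : Fin n → Fin n → Set
  Base u v = Good u × Full v × u ⊑ v

  opaque
    base? : ∀ u v → Dec (Base u v)
    base? u v = good? u ×-dec full? v ×-dec (u ⊑? v)

  Extra : Fin n → Fin n → Set
  Extra u v = Base u v × dI u ≡ 1 × 2 + load u ≤ k

  opaque
    extra? : ∀ u v → Dec (Extra u v)
    extra? u v = base? u v ×-dec (dI u ℕ.≟ 1) ×-dec (2 + load u ≤? k)

  -- `special?` is counted twice because that rule pays two half units.
  given : Fin n → ℕ
  given u = (# (base? u) + # (extra? u)) + ((# (special? u) + # (special? u)) + # (relay? u))

  received : Fin n → ℕ
  received v = (# (λ u → base? u v) + # (λ u → extra? u v))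
             + ((# (λ u → special? u v) + # (λ u → special? u v)) + # (λ u → relay? u v))

  ∑-given : ∑ received ≡ ∑ given
  ∑-given = begin
    ∑ received
      ≡⟨ split (λ v → # (λ u → base? u v)) _ _ _ ⟩
    _ ≡⟨ cong₂ _+_ (cong₂ _+_ (#-swap λ v u → base? u v) (#-swap λ v u → extra? u v))
                   (cong₂ _+_ (cong₂ _+_ (#-swap λ v u → special? u v) (#-swap λ v u → special? u v))
                              (#-swap λ v u → relay? u v)) ⟩
    _ ≡⟨ split (λ u → # (base? u)) _ _ _ ⟨
    ∑ given ∎
    where
    open ≡-Reasoning
    split : (f g h l : Fin n → ℕ) → ∑ (λ v → (f v + g v) + ((h v + h v) + l v)) ≡
            (∑ f + ∑ g) + ((∑ h + ∑ h) + ∑ l)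
    split f g h l = trans (∑-+ _ _) (cong₂ _+_ (∑-+ f g) (trans (∑-+ _ _) (cong (_+ ∑ l) (∑-+ h h))))

  load-mono : ∀ u → # (base? u) ≤ load u
  load-mono u = #-mono proj₂

  leaf-load<k : ∀ {u} → u ∉ I → dI u ≡ 1 → suc (load u) ≤ k
  leaf-load<k {u} u∉I leaf with dominated u∉I
  ... | q , q∈I , u~q = ≤-trans
    (#-strict (λ (_ , u⊑z) → ~-sym (u⊑z q u~q q∈I)) (~-sym u~q)
      λ (full , _) → <⇒≱ 2≤k (≤-trans (≤-reflexive (sym full)) (≤-reflexive leaf)))
    (≤-reflexive (reg q))

  -- The subtraction truncates to 0 at full vertices; their deficit of 1 is entered separately in
  -- `vertex-balance`.
  slack : Fin n → ℕ
  slack u with u ∈? I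
  ... | yes _ = 0
  ... | no _  = k ∸ suc (dI u)

  module _ {u : Fin n} where

    no-base : ¬ Good u → # (base? u) ≡ 0
    no-base ¬good = #-empty λ b → ¬good (proj₁ b)

    no-extra : ¬ (Good u × dI u ≡ 1 × 2 + load u ≤ k) → # (extra? u) ≡ 0
    no-extra ¬e = #-empty λ ((good , _) , leaf , ≤k) → ¬e (good , leaf , ≤k)

    no-special : ¬ (dI u ≡ 1 × Spare u) → # (special? u) ≡ 0
    no-special ¬s = #-empty λ (_ , leaf , spare , _) → ¬s (leaf , spare)

    no-relay : ¬ (u ∉ I × dI u ≡ 1 × load u ≡ 0 × ¬ Spare u) → # (relay? u) ≡ 0
    no-relay ¬r = #-empty λ (_ , u∉I , leaf , load≡0 , ¬spare , _) → ¬r (u∉I , leaf , load≡0 , ¬spare)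

    given≤ : ∀ {b e s r m} → # (base? u) ≤ b → # (extra? u) ≤ e → # (special? u) ≤ s → # (relay? u) ≤ r →
             (b + e) + ((s + s) + r) ≤ m → given u ≤ m
    given≤ b≤ e≤ s≤ r≤ = ≤-trans (+-mono-≤ (+-mono-≤ b≤ e≤) (+-mono-≤ (+-mono-≤ s≤ s≤) r≤))

    -- `e` is the slack. A class of size at least d(u) leaves room for at most k - d(u) = e + 1 full
    -- vertices above `u`. This may exceed e but not 2e, which is why the unit of payment is a half.
    non-leaf-budget : u ∉ I → dI u ≢ 1 → ∀ {e} → suc (dI u) + e ≡ k → given u ≤ 2 * e
    non-leaf-budget u∉I ¬leaf {e} k≡ with good? u
    ... | no ¬good = ≤-trans (given≤ (≤-reflexive (no-base ¬good))
            (≤-reflexive (no-extra λ (good , _) → ¬good good))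
            (≤-reflexive (no-special λ (leaf , _) → ¬leaf leaf))
            (≤-reflexive (no-relay λ (_ , leaf , _) → ¬leaf leaf)) ≤-refl) z≤n
    ... | yes good@(_ , 2+d≤k , d≤class) = given≤ (load-mono u)
            (≤-reflexive (no-extra λ (_ , leaf , _) → ¬leaf leaf))
            (≤-reflexive (no-special λ (leaf , _) → ¬leaf leaf))
            (≤-reflexive (no-relay λ (_ , leaf , _) → ¬leaf leaf)) bound
      where
      open ≤-Reasoning
      1≤e : 1 ≤ e
      1≤e = +-cancelˡ-≤ (suc (dI u)) _ _ (begin
        suc (dI u) + 1  ≡⟨ +-comm (suc (dI u)) 1 ⟩
        2 + dI u        ≤⟨ 2+d≤k ⟩
        k               ≡⟨ k≡ ⟨
        suc (dI u) + e  ∎)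
      load+class≤k : load u + # (class? u) ≤ k
      load+class≤k with dominated u∉I
      ... | q , q∈I , u~q = ≤-trans
        (#-⊎ (λ (_ , u⊑z) → ~-sym (u⊑z q u~q q∈I)) (λ (_ , _ , u⊑z) → ~-sym (u⊑z q u~q q∈I))
             λ (full , _) c → <⇒≱ (≤-trans (n≤1+n _) 2+d≤k)
               (≤-trans (≤-reflexive (sym full)) (≤-reflexive (class⇒≡ c))))
        (≤-reflexive (reg q))
      bound : load u + 0 + 0 ≤ 2 * e
      bound = begin
        load u + 0 + 0  ≡⟨ trans (+-identityʳ _) (+-identityʳ _) ⟩
        load u          ≤⟨ +-cancelˡ-≤ (dI u) _ _ (begin
          dI u + load u         ≤⟨ +-monoˡ-≤ _ d≤class ⟩
          # (class? u) + load u ≡⟨ +-comm (# (class? u)) _ ⟩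
          load u + # (class? u) ≤⟨ load+class≤k ⟩
          k                     ≡⟨ k≡ ⟨
          suc (dI u + e)        ≡⟨ +-suc (dI u) e ⟨
          dI u + suc e          ∎) ⟩
        suc e           ≤⟨ +-monoˡ-≤ e 1≤e ⟩
        e + e           ≡⟨ cong (e +_) (+-identityʳ e) ⟨
        2 * e           ∎

    special≤1 : dI u ≡ 1 → # (special? u) ≤ 1
    special≤1 leaf = #-unique special-unique
      where
      special-unique : ∀ {v v′} → Special u v → Special u v′ → v ≡ v′
      special-unique {v} {v′} (full , _ , _ , nbrs) (full′ , _ , _ , nbrs′)
        with #-∃∖ {P? = private-nbr? u} {Q? = u ~?_}
               (≤-trans (s≤s (≤-reflexive leaf)) (≤-trans 2≤k (≤-reflexive (sym (reg u)))))
      ... | w , u~w , ¬w∈I with dominated {w} (λ w∈I → ¬w∈I (u~w , w∈I))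
      ...   | r , r∈I , w~r = almost-all r W?
                (λ (u~z , z∉I) → ~-sym (proj₁ (proj₂ (nbrs w _ u~w w∉I u~z z∉I)) r w~r r∈I)) k≤W
                (~-sym (proj₂ (proj₂ (nbrs w w u~w w∉I u~w w∉I)) r w~r r∈I))
                (~-sym (proj₂ (proj₂ (nbrs′ w w u~w w∉I u~w w∉I)) r w~r r∈I))
                (λ (u~v , v∉I) → proj₂ (near (proj₁ (nbrs _ _ u~v v∉I u~v v∉I))) full)
                (λ (u~v , v∉I) → proj₂ (near (proj₁ (nbrs _ _ u~v v∉I u~v v∉I))) full′)
        where
        w∉I : w ∉ I
        w∉I w∈I = ¬w∈I (u~w , w∈I)
        W? : Decidable (λ z → u ~ z × z ∉ I)
        W? z = (u ~? z) ×-dec ¬? (z ∈? I)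
        split : ∀ {z} → u ~ z → (u ~ z × z ∈ I) ⊎ (u ~ z × z ∉ I)
        split {z} u~z with z ∈? I
        ... | yes z∈I = inj₁ (u~z , z∈I)
        ... | no z∉I = inj₂ (u~z , z∉I)
        k≤W : k ≤ suc (# W?)
        k≤W = ≤-trans (≤-reflexive (sym (reg u))) (≤-trans (#-∪ {Q? = private-nbr? u} split)
                (≤-reflexive (cong (_+ # W?) leaf)))

    relay<k : suc (# (relay? u)) ≤ k
    relay<k with any? (relay? u)
    ... | no ¬e = ≤-trans (s≤s (≤-reflexive (#-empty λ {v} r → ¬e (v , r))))
                          (≤-trans (n≤1+n 1) 2≤k)
    ... | yes (_ , _ , _ , _ , _ , _ , x , (x∉I , leaf , _) , _ , only) = ≤-trans
      (s≤s (#-mono λ { (full , _ , _ , _ , _ , y , l , y⊑v , _) →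
        full , subst (_⊑ _) (only y l) y⊑v }))
      (leaf-load<k x∉I leaf)

    -- An I-neighbour of `u` has at most one neighbour beyond the k - 1 counted by `Spare`, and
    -- these are not full as k > 2.
    spare⇒load≤1 : u ∉ I → Spare u → load u ≤ 1
    spare⇒load≤1 u∉I spare with dominated u∉I
    ... | q , q∈I , u~q = +-cancelʳ-≤ _ (load u) 1 (≤-trans (≤-trans
      (#-⊎ {R? = q ~?_} (λ (_ , u⊑z) → ~-sym (u⊑z q u~q q∈I)) (λ (_ , _ , u⊑z) → ~-sym (u⊑z q u~q q∈I))
           λ (full , _) (_ , ≤2 , _) → <⇒≱ 3≤k (≤-trans (≤-reflexive (sym full)) ≤2))
      (≤-reflexive (reg q))) spare)

    -- Now e = k - 2. With `Spare` the payments are at most 1 + 1 + 2, which is where k ≥ 4 is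
    -- needed. Without it, a load of 0 leaves only the at most k - 1 = e + 1 relays; a load between
    -- 1 and k - 2 is paid twice, at most 2e; a load of k - 1 = e + 1 is paid once.
    leaf-budget : u ∉ I → dI u ≡ 1 → ∀ {e} → 2 + e ≡ k → given u ≤ 2 * e
    leaf-budget u∉I leaf {e} refl with spare? u
    ... | yes spare = given≤ (≤-trans (load-mono u) load≤1) (≤-trans (#-mono proj₁) (≤-trans (load-mono u) load≤1))
            (special≤1 leaf) (≤-reflexive (no-relay λ (_ , _ , _ , ¬spare) → ¬spare spare))
            (*-monoʳ-≤ 2 (≤-pred (≤-pred 4≤k)))
      where
      load≤1 = spare⇒load≤1 u∉I spare
    ... | no ¬spare with load u ℕ.≟ 0
    ...   | yes load≡0 = given≤ (≤-trans (load-mono u) (≤-reflexive load≡0))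
              (≤-trans (#-mono proj₁) (≤-trans (load-mono u) (≤-reflexive load≡0)))
              (≤-reflexive (no-special λ (_ , spare) → ¬spare spare)) (≤-pred relay<k) suc-e≤
      where
      suc-e≤ : suc e ≤ 2 * e
      suc-e≤ = ≤-trans (+-monoˡ-≤ e (≤-pred (≤-pred 3≤k))) (≤-reflexive (cong (e +_) (sym (+-identityʳ e))))
    ...   | no load≢0 with 2 + load u ≤? 2 + e
    ...     | yes 2+load≤k = given≤ (load-mono u) (≤-trans (#-mono proj₁) (load-mono u))
              (≤-reflexive (no-special λ (_ , spare) → ¬spare spare)) (≤-reflexive (no-relay λ (_ , _ , load≡0 , _) → load≢0 load≡0))
              (≤-trans (≤-reflexive (+-identityʳ _)) (≤-trans (+-mono-≤ load≤e load≤e)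
                (≤-reflexive (cong (e +_) (sym (+-identityʳ e))))))
      where
      load≤e = ≤-pred (≤-pred 2+load≤k)
    ...     | no ¬2+load≤k = given≤ (≤-trans (load-mono u) (≤-pred (leaf-load<k u∉I leaf)))
              (≤-reflexive (no-extra λ (_ , _ , 2+load≤k) → ¬2+load≤k 2+load≤k))
              (≤-reflexive (no-special λ (_ , spare) → ¬spare spare)) (≤-reflexive (no-relay λ (_ , _ , load≡0 , _) → load≢0 load≡0))
              (≤-trans (≤-reflexive (trans (+-identityʳ _) (+-identityʳ _)))
                (≤-trans (+-monoˡ-≤ e (≤-pred (≤-pred 3≤k))) (≤-reflexive (cong (e +_) (sym (+-identityʳ e))))))

  budget : ∀ u → given u ≤ 2 * slack u
  budget u with u ∈? I
  ... | yes u∈I = given≤ (≤-reflexive (no-base λ good → proj₁ good u∈I))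
          (≤-reflexive (no-extra λ (good , _) → proj₁ good u∈I))
          (≤-reflexive (no-special λ (leaf , _) → 1+n≢0 (trans (sym leaf) (∈⇒dI≡0 u∈I))))
          (≤-reflexive (no-relay λ (u∉I , _) → u∉I u∈I)) ≤-refl
  ... | no u∉I with dI u ℕ.≟ 1
  ...   | yes leaf = leaf-budget u∉I leaf (trans (cong (λ m → 2 + (k ∸ suc m)) leaf) (m+[n∸m]≡n 2≤k))
  ...   | no ¬leaf with suc (dI u) ≤? k
  ...     | yes d<k = non-leaf-budget u∉I ¬leaf (m+[n∸m]≡n d<k)
  ...     | no d≮k = ≤-trans (given≤ (≤-reflexive (no-base ¬good))
            (≤-reflexive (no-extra λ (good , _) → ¬good good))
            (≤-reflexive (no-special λ (leaf , _) → ¬leaf leaf))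
            (≤-reflexive (no-relay λ (_ , leaf , _) → ¬leaf leaf)) ≤-refl) z≤n
    where
    ¬good : ¬ Good u
    ¬good (_ , 2+d≤k , _) = d≮k (≤-trans (n≤1+n _) 2+d≤k)

  -- A vertex below `y` with d ≤ k - 2 would have a good vertex below it. So all vertices below `y`
  -- have the same k - 1 neighbours in `I` as `y`.
  near-class : ∀ {y} → y ∉ I → suc (dI y) ≡ k → (∀ u → Good u → ¬ u ⊑ y) → k ≤ suc (# (class? y))
  near-class {y} y∉I y-near ¬good = ≤-trans (≤-reflexive (sym y-near))
    (s≤s (≤-trans (dI≤#below y∉I) (#-mono below⇒class)))
    where
    below⇒class : ∀ {z} → z ∉ I × z ⊑ y → Class y z
    below⇒class {z} (z∉I , z⊑y) with 2 + dI z ≤? k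
    ... | no 2+d≰k = z∉I , z⊑y , ⊑∧≥⇒⊒ z⊑y (≤-pred (≤-trans (≤-reflexive y-near) (≤-pred (≰⇒> 2+d≰k))))
    ... | yes 2+d≤k with good-below z∉I 2+d≤k
    ...   | u , good , u⊑z = ⊥-elim (¬good u good (⊑-trans u⊑z z⊑y))

  module Receive {v : Fin n} (full : Full v) where

    below-full⇒twin : ∀ {y} → y ⊑ v → Full y → Twin v y
    below-full⇒twin y⊑v full-y x v~x =
      ⊑∧≥⇒⊒ y⊑v (≤-reflexive (trans full (sym full-y))) x v~x (full⇒∈ full v~x)

    payers≤base : payers v ≤ # (λ u → base? u v)
    payers≤base = #-mono λ (good , u⊑v) → good , full , u⊑v

    2≤received : 2 ≤ received v
    2≤received with 2 ≤? payers v
    ... | yes 2≤payers = ≤-trans (≤-trans 2≤payers payers≤base) (≤-trans (m≤m+n _ _) (m≤m+n _ _))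
    ... | no 2≰payers with any? (λ y → below? v y ×-dec (suc (dI y) ℕ.≟ k)
                              ×-dec ¬? (any? λ u → good? u ×-dec (u ⊑? y)))
    ...   | yes (y , (y∉I , y⊑v) , y-near , ¬good) = special-pays
              (TypeA.special full y∉I y-near y⊑v
                (near-class y∉I y-near λ u good u⊑y → ¬good (u , good , u⊑y)) (≤-pred (≰⇒> 2≰payers)))
      where
      special-pays : ∃[ a ] Special a v → 2 ≤ received v
      special-pays (a , sp) = ≤-trans (+-mono-≤ 1≤special 1≤special) (≤-trans (m≤m+n _ _) (m≤n+m _ (# (λ u → base? u v) + _)))
        where
        1≤special : 1 ≤ # (λ u → special? u v)
        1≤special = #-inhabited sp
    ...   | no ¬near-below = by-leaf (any? λ u → good? u ×-dec (u ⊑? v))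
      where
      payers≤1 : payers v ≤ 1
      payers≤1 = ≤-pred (≰⇒> 2≰payers)

      good-under : ∀ {y} → y ∉ I → y ⊑ v → ¬ Full y → ∃[ u ] Good u × u ⊑ y
      good-under {y} y∉I y⊑v ¬full with 2 + dI y ≤? k
      ... | yes 2+d≤k = good-below y∉I 2+d≤k
      ... | no 2+d≰k = decidable-stable (any? λ u → good? u ×-dec (u ⊑? y)) λ ¬good →
        ¬near-below (y , (y∉I , y⊑v) , ≤-antisym (≤∧≢⇒< (dI≤k y) ¬full) (≤-pred (≰⇒> 2+d≰k)) , ¬good)

      -- The class of a payer consists of payers, so here it has one element, and d is at most the
      -- size of the class.
      payer-leaf : ∀ {u} → Good u → u ⊑ v → dI u ≡ 1
      payer-leaf good@(u∉I , _ , d≤class) u⊑v = ≤-antisym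
        (≤-trans d≤class (≤-trans (#-mono λ c → class-good good c , ⊑-trans (proj₁ (proj₂ c)) u⊑v) payers≤1))
        (∉⇒1≤dI u∉I)

      by-leaf : Dec (∃[ u ] Good u × u ⊑ v) → 2 ≤ received v
      -- Without payers everything below `v` is full, hence a twin of `v`, and there would be k
      -- twins.
      by-leaf (no ¬good) = ⊥-elim (<⇒≱ (#twin<k v) (≤-trans (≤-reflexive (sym full))
        (≤-trans (dI≤#below (full⇒∉ full)) (#-mono λ {y} (y∉I , y⊑v) → below-full⇒twin y⊑v
          (decidable-stable (full? y) λ ¬full → no-good (good-under y∉I y⊑v ¬full) y⊑v)))))
        where
        no-good : ∀ {y} → ∃[ u ] Good u × u ⊑ y → ¬ y ⊑ v
        no-good (u , good , u⊑y) y⊑v = ¬good (u , good , ⊑-trans u⊑y y⊑v)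
      by-leaf (yes (u , u-good@(u∉I , _) , u⊑v)) with 2 + load u ≤? k
      ... | yes 2+load≤k = ≤-trans
              (+-mono-≤ (#-inhabited {P? = λ u → base? u v} base)
                        (#-inhabited {P? = λ u → extra? u v} (base , payer-leaf u-good u⊑v , 2+load≤k)))
              (m≤m+n _ _)
        where
        base : Base u v
        base = u-good , full , u⊑v
      ... | no 2+load≰k = ≤-trans (+-mono-≤ (#-inhabited {P? = λ u → base? u v} (u-good , full , u⊑v))
                (#-inhabited {P? = λ u → relay? u v} (proj₂ relayed)))
              (+-mono-≤ (m≤m+n (# (λ u → base? u v)) _) (m≤n+m (# (λ u → relay? u v)) _))
        where
        leaf : dI u ≡ 1
        leaf = payer-leaf u-good u⊑v
        ¬full-u : ¬ Full u
        ¬full-u full-u = <⇒≱ 2≤k (≤-trans (≤-reflexive (sym full-u)) (≤-reflexive leaf))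
        -- The load of `u` is at least k - 1, so all neighbours of `q` other than `u` are full.
        crowded : ∀ {z} → u ⊑ z → Full z ⊎ z ≡ u
        crowded {z} u⊑z with dominated u∉I
        ... | q , q∈I , u~q = Sum.map₁ proj₁ (almost-all′ q (λ z → full? z ×-dec (u ⊑? z))
                (λ (_ , u⊑z) → ~-sym (u⊑z q u~q q∈I)) (≤-pred (≰⇒> 2+load≰k)) (~-sym u~q)
                (λ (full-u , _) → ¬full-u full-u) (~-sym (u⊑z q u~q q∈I)))
        twin-or-u : ∀ {y} → y ∉ I × y ⊑ v → Twin v y ⊎ y ≡ u
        twin-or-u {y} (y∉I , y⊑v) with full? y
        ... | yes full-y = inj₁ (below-full⇒twin y⊑v full-y)
        ... | no ¬full with good-under y∉I y⊑v ¬full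
        ...   | u′ , good′ , u′⊑y with u′ ≟ u
        ...     | no u′≢u = ⊥-elim (<⇒≱ (#-pair {P? = λ z → good? z ×-dec (z ⊑? v)}
                    (good′ , ⊑-trans u′⊑y y⊑v) (u-good , u⊑v) u′≢u) payers≤1)
        ...     | yes refl with crowded u′⊑y
        ...       | inj₁ full-y = ⊥-elim (¬full full-y)
        ...       | inj₂ y≡u = inj₂ y≡u
        rich-v : Rich v
        rich-v = begin
          k                        ≡⟨ full ⟨
          dI v                     ≤⟨ dI≤#below (full⇒∉ full) ⟩
          # (below? v)             ≤⟨ #-∪ {Q? = twin? v} {R? = _≟ u} twin-or-u ⟩
          # (twin? v) + # (_≟ u)   ≤⟨ +-monoʳ-≤ _ (#-singleton≤1 u) ⟩
          # (twin? v) + 1          ≡⟨ +-comm _ 1 ⟩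
          suc (# (twin? v))        ∎
          where open ≤-Reasoning
        relayed : ∃[ x ] Relay x v
        relayed = TypeB.relayed full u-good leaf u⊑v rich-v crowded payers≤1

  #full≤∑slack : # full? ≤ ∑ slack
  #full≤∑slack = *-cancelˡ-≤ 2 (begin
    2 * # full?                  ≡⟨ cong (2 *_) (#≡∑ full?) ⟩
    2 * ∑ (λ v → ⟦ full? v ⟧)    ≡⟨ ∑-*ˡ 2 _ ⟨
    ∑ (λ v → 2 * ⟦ full? v ⟧)    ≤⟨ ∑-mono (λ v → le v (full? v)) ⟩
    ∑ received                   ≡⟨ ∑-given ⟩
    ∑ given                      ≤⟨ ∑-mono budget ⟩
    ∑ (λ u → 2 * slack u)        ≡⟨ ∑-*ˡ 2 slack ⟩
    2 * ∑ slack                  ∎)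
    where
    open ≤-Reasoning
    le : ∀ v (full? : Dec (Full v)) → 2 * ⟦ full? ⟧ ≤ received v
    le v (yes full) = Receive.2≤received full
    le v (no _)     = z≤n

  -- Counting the edges between I and its complement.

  outside? : Decidable (_∉ I)
  outside? v = ¬? (v ∈? I)

  ∑dI≡k*#I : ∑ dI ≡ k * # (_∈? I)
  ∑dI≡k*#I = begin
    ∑ dI                              ≡⟨ #-swap (λ u x → (u ~? x) ×-dec (x ∈? I)) ⟩
    ∑ (λ x → # (λ u → (u ~? x) ×-dec (x ∈? I)))  ≡⟨ ∑-cong (λ x → col x (x ∈? I)) ⟩
    ∑ (λ x → k * ⟦ x ∈? I ⟧)          ≡⟨ ∑-*ˡ k _ ⟩
    k * ∑ (λ x → ⟦ x ∈? I ⟧)          ≡⟨ cong (k *_) (#≡∑ (_∈? I)) ⟨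
    k * # (_∈? I)                     ∎
    where
    open ≡-Reasoning
    col : ∀ x (x∈? : Dec (x ∈ I)) → # (λ u → (u ~? x) ×-dec (x ∈? I)) ≡ k * ⟦ x∈? ⟧
    col x (yes x∈I) = trans (trans (#-cong (λ (u~x , _) → ~-sym u~x) (λ x~u → ~-sym x~u , x∈I)) (reg x))
                            (sym (*-identityʳ k))
    col x (no x∉I) = trans (#-empty λ (_ , x∈I) → x∉I x∈I) (sym (*-zeroʳ k))

  vertex-balance : ∀ u → dI u + (⟦ outside? u ⟧ + slack u) ≤ k * ⟦ outside? u ⟧ + ⟦ full? u ⟧
  vertex-balance u with u ∈? I
  ... | yes u∈I rewrite ∈⇒dI≡0 u∈I = z≤n
  ... | no u∉I with dI u ℕ.≟ k
  ...   | yes full rewrite full = begin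
    k + suc (k ∸ suc k)  ≡⟨ cong (λ m → k + suc m) (m≤n⇒m∸n≡0 (n≤1+n k)) ⟩
    k + 1                ≡⟨ cong (_+ 1) (*-identityʳ k) ⟨
    k * 1 + 1            ∎
    where open ≤-Reasoning
  ...   | no ¬full = begin
    dI u + suc (k ∸ suc (dI u))  ≡⟨ +-suc (dI u) _ ⟩
    suc (dI u) + (k ∸ suc (dI u)) ≡⟨ m+[n∸m]≡n (≤∧≢⇒< (dI≤k u) ¬full) ⟩
    k                            ≡⟨ trans (+-identityʳ _) (*-identityʳ k) ⟨
    k * 1 + 0                    ∎
    where open ≤-Reasoning

  balance : k * # (_∈? I) + # outside? ≤ k * # outside?
  balance = +-cancelʳ-≤ (∑ slack) _ _ (begin
    k * # (_∈? I) + # outside? + ∑ slack        ≡⟨ +-assoc (k * # (_∈? I)) _ _ ⟩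
    k * # (_∈? I) + (# outside? + ∑ slack)      ≡⟨ cong₂ (λ a b → a + (b + ∑ slack)) (sym ∑dI≡k*#I) (#≡∑ outside?) ⟩
    ∑ dI + (∑ (λ u → ⟦ outside? u ⟧) + ∑ slack) ≡⟨ trans (∑-+ _ _) (cong (∑ dI +_) (∑-+ _ _)) ⟨
    ∑ (λ u → dI u + (⟦ outside? u ⟧ + slack u)) ≤⟨ ∑-mono vertex-balance ⟩
    ∑ (λ u → k * ⟦ outside? u ⟧ + ⟦ full? u ⟧)  ≡⟨ trans (∑-+ _ _) (cong (_+ ∑ (λ u → ⟦ full? u ⟧)) (∑-*ˡ k _)) ⟩
    k * ∑ (λ u → ⟦ outside? u ⟧) + ∑ (λ u → ⟦ full? u ⟧) ≡⟨ cong₂ (λ a b → k * a + b) (#≡∑ outside?) (#≡∑ full?) ⟨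
    k * # outside? + # full?                    ≤⟨ +-monoʳ-≤ _ #full≤∑slack ⟩
    k * # outside? + ∑ slack                    ∎)
    where open ≤-Reasoning

  #I+#outside≡n : # (_∈? I) + # outside? ≡ n
  #I+#outside≡n = ≤-antisym
    (≤-trans (#-⊎ {R? = U?} _ _ (λ x∈ x∉ → x∉ x∈)) #≤n)
    (≤-trans (≤-reflexive (sym (#-all {P? = U?} _)))
             (#-∪ {Q? = _∈? I} {R? = outside?} λ {x} _ → split x))
    where
    split : ∀ x → x ∈ I ⊎ x ∉ I
    split x with x ∈? I
    ... | yes x∈I = inj₁ x∈I
    ... | no x∉I = inj₂ x∉I

  -- (2k - 1)|I| ≤ (k - 1)n, with both sides moved so that no subtraction occurs.
  2k*#I+n≤ : k * # (_∈? I) + (k * # (_∈? I) + n) ≤ k * n + # (_∈? I)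
  2k*#I+n≤ = begin
    k * i + (k * i + n)         ≡⟨ cong (λ m → k * i + (k * i + m)) (trans (+-comm o i) #I+#outside≡n) ⟨
    k * i + (k * i + (o + i))   ≡⟨ cong (k * i +_) (+-assoc (k * i) o i) ⟨
    k * i + (k * i + o + i)     ≤⟨ +-monoʳ-≤ (k * i) (+-monoˡ-≤ i balance) ⟩
    k * i + (k * o + i)         ≡⟨ +-assoc (k * i) _ i ⟨
    k * i + k * o + i           ≡⟨ cong (_+ i) (*-distribˡ-+ k i o) ⟨
    k * (i + o) + i             ≡⟨ cong (λ m → k * m + i) #I+#outside≡n ⟩
    k * n + i                   ∎
    where
    open ≤-Reasoning
    i = # (_∈? I)
    o = # outside?

-- Bounds on n and i from a dominating set D, with m = k - 2.

module ViaDominatingSet {n : ℕ} (G : Graph n) (m : ℕ) (2≤m : 2 ≤ m)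
  (reg : ∀ v → # (Neighbours._~?_ G v) ≡ 2 + m) (D : Subset n) (dom : Dominating G D) where

  open Neighbours G

  Isolated Joined : Fin n → Set
  Isolated v = v ∈ D × d D v ≡ 0
  Joined v = v ∈ D × d D v ≢ 0

  isolated? : Decidable Isolated
  isolated? v = (v ∈? D) ×-dec (d D v ℕ.≟ 0)

  joined? : Decidable Joined
  joined? v = (v ∈? D) ×-dec ¬? (d D v ℕ.≟ 0)

  isolated-or-joined : ∀ {v} → v ∈ D → Isolated v ⊎ Joined v
  isolated-or-joined {v} v∈D with d D v ℕ.≟ 0
  ... | yes d≡0 = inj₁ (v∈D , d≡0)
  ... | no d≢0  = inj₂ (v∈D , d≢0)

  #D≡ : # (_∈? D) ≡ # isolated? + # joined?
  #D≡ = ≤-antisym (#-∪ isolated-or-joined) (#-⊎ proj₁ proj₁ λ (_ , d≡0) (_ , d≢0) → d≢0 d≡0)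

  outer? : ∀ v → Decidable (λ x → v ~ x × x ∉ D)
  outer? v x = (v ~? x) ×-dec ¬? (x ∈? D)

  d+#outer≤ : ∀ v → d D v + # (outer? v) ≤ 2 + m
  d+#outer≤ v = ≤-trans (#-⊎ proj₁ proj₁ λ (_ , x∈D) (_ , x∉D) → x∉D x∈D) (≤-reflexive (reg v))

  #outer≤ : ∀ j v → j ≤ d D v → j + # (outer? v) ≤ 2 + m
  #outer≤ j v j≤d = ≤-trans (+-monoˡ-≤ _ j≤d) (d+#outer≤ v)

  -- A vertex of `D` accounts for itself and its neighbours outside `D`: up to k + 1 vertices if it
  -- is isolated in G[D], at most k otherwise.
  n≤ : n ≤ (3 + m) * # isolated? + (2 + m) * # joined?
  n≤ = begin
    n                                        ≡⟨ #-all _ ⟨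
    # (U? {A = Fin n})                       ≤⟨ #-∪ {Q? = _∈? D} {R? = λ v → ¬? (v ∈? D)} (λ {v} _ → in-or-out v) ⟩
    # (_∈? D) + # (λ v → ¬? (v ∈? D))        ≤⟨ +-monoʳ-≤ _ (#-cover (λ v → ¬? (v ∈? D)) M? c cover bound) ⟩
    # (_∈? D) + ∑ c                          ≡⟨ cong₂ _+_ #D≡ ∑c≡ ⟩
    i + j + ((2 + m) * i + (1 + m) * j)      ≡⟨ collect m i j ⟩
    (3 + m) * i + (2 + m) * j                ∎
    where
    open ≤-Reasoning
    i = # isolated?
    j = # joined?
    collect : ∀ m i j → i + j + ((2 + m) * i + (1 + m) * j) ≡ (3 + m) * i + (2 + m) * j
    collect = solve-∀
    in-or-out : ∀ v → v ∈ D ⊎ v ∉ D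
    in-or-out v with v ∈? D
    ... | yes v∈D = inj₁ v∈D
    ... | no v∉D = inj₂ v∉D
    M? : ∀ x v → Dec (v ∈ D × v ~ x × x ∉ D)
    M? x v = (v ∈? D) ×-dec outer? v x
    c : Fin n → ℕ
    c v = (2 + m) * ⟦ isolated? v ⟧ + (1 + m) * ⟦ joined? v ⟧
    ∑c≡ : ∑ c ≡ (2 + m) * i + (1 + m) * j
    ∑c≡ = trans (∑-+ _ _) (cong₂ _+_
      (trans (∑-*ˡ (2 + m) _) (cong ((2 + m) *_) (sym (#≡∑ isolated?))))
      (trans (∑-*ˡ (1 + m) _) (cong ((1 + m) *_) (sym (#≡∑ joined?)))))
    cover : ∀ {x} → x ∉ D → ∃[ v ] v ∈ D × v ~ x × x ∉ D
    cover x∉D with dom _ x∉D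
    ... | v , v∈D , x~v = v , v∈D , ~-sym x~v , x∉D
    bound′ : ∀ v → Dec (v ∈ D) → # (λ x → M? x v) ≤ c v
    bound′ v (no v∉D) = ≤-trans (≤-reflexive (#-empty λ (v∈D , _) → v∉D v∈D)) z≤n
    bound′ v (yes v∈D) with isolated-or-joined v∈D
    ... | inj₁ iso = begin
      _                              ≤⟨ #-mono proj₂ ⟩
      # (outer? v)                   ≤⟨ #outer≤ 0 v z≤n ⟩
      2 + m                          ≡⟨ *-identityʳ _ ⟨
      (2 + m) * 1                    ≡⟨ cong ((2 + m) *_) (⟦⟧-yes (isolated? v) iso) ⟨
      (2 + m) * ⟦ isolated? v ⟧      ≤⟨ m≤m+n _ _ ⟩
      c v                            ∎
    ... | inj₂ joined = begin
      _                              ≤⟨ #-mono proj₂ ⟩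
      # (outer? v)                   ≤⟨ ≤-pred (#outer≤ 1 v (n≢0⇒n>0 (proj₂ joined))) ⟩
      1 + m                          ≡⟨ *-identityʳ _ ⟨
      (1 + m) * 1                    ≡⟨ cong ((1 + m) *_) (⟦⟧-yes (joined? v) joined) ⟨
      (1 + m) * ⟦ joined? v ⟧        ≤⟨ m≤n+m _ ((2 + m) * ⟦ isolated? v ⟧) ⟩
      c v                            ∎
    bound : ∀ v → # (λ x → M? x v) ≤ c v
    bound v = bound′ v (v ∈? D)

  Leaf : Fin n → Set
  Leaf v = v ∈ D × d D v ≡ 1

  -- Of the two leaves of a K₂-component of G[D] only the smaller one is chosen.
  Chosen : Fin n → Set
  Chosen v = Leaf v × (∀ w → v ~ w → Leaf w → v Fin.< w)

  chosen? : Decidable Chosen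
  chosen? v = leaf? v ×-dec all? λ w → (v ~? w) →-dec (leaf? w →-dec (v Fin.<? w))
    where
    leaf? : Decidable Leaf
    leaf? v = (v ∈? D) ×-dec (d D v ℕ.≟ 1)

  opaque
    skeleton : ∃[ A ] Independent G A × (∀ v → v ∈ D → v ∉ A → ∃[ u ] u ∈ A × v ~ u)
                    × (∀ {x} → Chosen x → x ∈ A) × (∀ {x} → x ∈ A → x ∈ D)
    skeleton with extend-within (_∈? D) ⟪ chosen? ⟫ chosen-ind
      where
      chosen-ind : Independent G ⟪ chosen? ⟫
      chosen-ind v w v∈ w∈ v~w with ∈⟪⟫⁻ chosen? v∈ | ∈⟪⟫⁻ chosen? w∈
      ... | leaf-v , v< | leaf-w , w< = <-asym (v< w v~w leaf-w) (w< v (~-sym v~w) leaf-v)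
    ... | A , ind , dom-A , ⊆A , A⊆ = A , ind , dom-A , ⊆A ∘ ∈⟪⟫⁺ chosen?
          , [ proj₁ ∘ proj₁ ∘ ∈⟪⟫⁻ chosen? , id ] ∘ A⊆

  -- A vertex of `J` outside `D` has no neighbour in `A`, so it is dominated from the rest of `D`. A
  -- vertex of the rest has at most m neighbours outside `D`, or m + 1 if it is a leaf, and such
  -- leaves are no more numerous than the non-isolated vertices of `A`.
  independent-dominating-set : ∃[ J ] IndependentDominating G J × # (_∈? J) ≤ # isolated? + m * # joined?
  independent-dominating-set with skeleton
  ... | A , ind-A , dom-A , chosen⊆A , A⊆D with extend A ind-A
  ...   | J , ids@(ind-J , _) , A⊆J = J , ids , #J≤
    where
    Rest : Fin n → Set
    Rest v = v ∈ D × v ∉ A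

    rest? : Decidable Rest
    rest? v = (v ∈? D) ×-dec ¬? (v ∈? A)

    leaf-rest? : Decidable (λ v → Leaf v × v ∉ A)
    leaf-rest? v = ((v ∈? D) ×-dec (d D v ℕ.≟ 1)) ×-dec ¬? (v ∈? A)

    A₁? : Decidable (λ v → v ∈ A × d D v ≢ 0)
    A₁? v = (v ∈? A) ×-dec ¬? (d D v ℕ.≟ 0)

    rest⇒1≤d : ∀ {v} → Rest v → 1 ≤ d D v
    rest⇒1≤d (v∈D , v∉A) with dom-A _ v∈D v∉A
    ... | u , u∈A , v~u = #-inhabited (v~u , A⊆D u∈A)

    -- A leaf outside A is the larger end of a K₂-component, whose other end is in A.
    #leaf-rest≤ : # leaf-rest? ≤ # A₁?
    #leaf-rest≤ = ≤-trans (#-cover leaf-rest? M? (λ a → ⟦ A₁? a ⟧) cover bound) (≤-reflexive (sym (#≡∑ A₁?)))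
      where
      M? : ∀ v a → Dec ((a ∈ A × d D a ≡ 1) × a ~ v × v ∈ D)
      M? v a = ((a ∈? A) ×-dec (d D a ℕ.≟ 1)) ×-dec ((a ~? v) ×-dec (v ∈? D))
      cover : ∀ {v} → Leaf v × v ∉ A → ∃[ a ] (a ∈ A × d D a ≡ 1) × a ~ v × v ∈ D
      cover {v} (leaf-v@(v∈D , d≡1) , v∉A)
        with any? (λ w → (v ~? w) ×-dec ((w ∈? D) ×-dec (d D w ℕ.≟ 1)) ×-dec ¬? (v Fin.<? w))
      ... | no ¬e = ⊥-elim (v∉A (chosen⊆A (leaf-v , λ w v~w leaf-w →
              decidable-stable (v Fin.<? w) λ v≮w → ¬e (w , v~w , leaf-w , v≮w))))
      ... | yes (w , v~w , leaf-w@(w∈D , dw≡1) , v≮w) =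
              w , (chosen⊆A (leaf-w , λ w′ w~w′ (w′∈D , _) → subst (w Fin.<_) (only w~w′ w′∈D) w<v) , dw≡1)
              , ~-sym v~w , v∈D
        where
        only : ∀ {w′} → w ~ w′ → w′ ∈ D → v ≡ w′
        only {w′} w~w′ w′∈D = decidable-stable (v ≟ w′) λ v≢w′ → <⇒≱
          (#-pair {P? = λ x → (w ~? x) ×-dec (x ∈? D)} (~-sym v~w , v∈D) (w~w′ , w′∈D) v≢w′)
          (≤-reflexive dw≡1)
        w<v : w Fin.< v
        w<v = ≤∧≢⇒< (≮⇒≥ v≮w) λ w≡v → ~-irr (subst (v ~_) (toℕ-injective w≡v) v~w)
      bound : ∀ a → # (λ v → M? v a) ≤ ⟦ A₁? a ⟧
      bound a with (a ∈? A) ×-dec (d D a ℕ.≟ 1)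
      ... | no ¬a = ≤-trans (≤-reflexive (#-empty λ (a , _) → ¬a a)) z≤n
      ... | yes (a∈A , d≡1) = ≤-trans (#-mono proj₂) (≤-reflexive (trans d≡1
              (sym (⟦⟧-yes (A₁? a) (a∈A , λ d≡0 → 1+n≢0 (trans (sym d≡1) d≡0))))))

    #outside≤ : # (λ x → (x ∈? J) ×-dec ¬? (x ∈? D)) ≤ m * # rest? + # leaf-rest?
    #outside≤ = begin
      _                                    ≤⟨ #-cover _ M? c cover (λ v → bound v (rest? v)) ⟩
      ∑ c                                  ≡⟨ trans (∑-+ _ _) (cong₂ _+_
                                                (trans (∑-*ˡ m _) (cong (m *_) (sym (#≡∑ rest?))))
                                                (sym (#≡∑ leaf-rest?))) ⟩
      m * # rest? + # leaf-rest?           ∎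
      where
      open ≤-Reasoning
      M? : ∀ x v → Dec (Rest v × v ~ x × x ∉ D)
      M? x v = rest? v ×-dec outer? v x
      c : Fin n → ℕ
      c v = m * ⟦ rest? v ⟧ + ⟦ leaf-rest? v ⟧
      cover : ∀ {x} → x ∈ J × x ∉ D → ∃[ v ] Rest v × v ~ x × x ∉ D
      cover (x∈J , x∉D) with dom _ x∉D
      ... | v , v∈D , x~v = v , (v∈D , λ v∈A → ind-J _ _ x∈J (A⊆J v∈A) x~v) , ~-sym x~v , x∉D
      rest-bound : ∀ v → Rest v → Dec (d D v ≡ 1) → # (λ x → M? x v) ≤ c v
      rest-bound v r@(v∈D , v∉A) (yes d≡1) = begin
        _                                       ≤⟨ #-mono proj₂ ⟩
        # (outer? v)                            ≤⟨ ≤-pred (#outer≤ 1 v (≤-reflexive (sym d≡1))) ⟩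
        1 + m                                   ≡⟨ +-comm 1 m ⟩
        m + 1                                   ≡⟨ cong₂ _+_ (trans (sym (*-identityʳ m)) (cong (m *_) (sym (⟦⟧-yes (rest? v) r))))
                                                     (sym (⟦⟧-yes (leaf-rest? v) ((v∈D , d≡1) , v∉A))) ⟩
        c v                                     ∎
      rest-bound v r (no d≢1) = begin
        _                                       ≤⟨ #-mono proj₂ ⟩
        # (outer? v)                            ≤⟨ ≤-pred (≤-pred (#outer≤ 2 v (≤∧≢⇒< (rest⇒1≤d r) (d≢1 ∘ sym)))) ⟩
        m                                       ≡⟨ trans (sym (*-identityʳ m)) (cong (m *_) (sym (⟦⟧-yes (rest? v) r))) ⟩
        m * ⟦ rest? v ⟧                         ≤⟨ m≤m+n _ _ ⟩
        c v                                     ∎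
      bound : ∀ v → Dec (Rest v) → # (λ x → M? x v) ≤ c v
      bound v (no ¬r) = ≤-trans (≤-reflexive (#-empty λ (r , _) → ¬r r)) z≤n
      bound v (yes r) = rest-bound v r (d D v ℕ.≟ 1)

    #J≤ : # (_∈? J) ≤ # isolated? + m * # joined?
    #J≤ = begin
      # (_∈? J)
        ≤⟨ #-∪ {Q? = _∈? A} split-J ⟩
      # (_∈? A) + # (λ x → (x ∈? J) ×-dec ¬? (x ∈? D))
        ≤⟨ +-mono-≤ (#-∪ {Q? = isolated?} {R? = A₁?} split-A) (≤-trans #outside≤ (+-monoʳ-≤ _ #leaf-rest≤)) ⟩
      i + a + (m * r + a)      ≡⟨ +-assoc i a _ ⟩
      i + (a + (m * r + a))    ≡⟨ cong (i +_) (trans (cong (a +_) (+-comm (m * r) a)) (sym (+-assoc a a _))) ⟩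
      i + (a + a + m * r)      ≡⟨ cong (λ x → i + (a + x + m * r)) (+-identityʳ a) ⟨
      -- One `a` counts vertices of `A`, the other the excess of the leaves; m ≥ 2 absorbs both.
      i + (2 * a + m * r)      ≤⟨ +-monoʳ-≤ i (+-monoˡ-≤ _ (*-monoˡ-≤ a 2≤m)) ⟩
      i + (m * a + m * r)      ≡⟨ cong (i +_) (*-distribˡ-+ m a r) ⟨
      i + m * (a + r)          ≤⟨ +-monoʳ-≤ i (*-monoʳ-≤ m (#-⊎ (λ (v∈A , d≢0) → A⊆D v∈A , d≢0)
                                    (λ rest → proj₁ rest , λ d≡0 → <⇒≱ (rest⇒1≤d rest) (≤-reflexive d≡0))
                                    λ (v∈A , _) (_ , v∉A) → v∉A v∈A)) ⟩
      i + m * # joined?        ∎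
      where
      open ≤-Reasoning
      i = # isolated?
      a = # A₁?
      r = # rest?
      split-A : ∀ {v} → v ∈ A → Isolated v ⊎ (v ∈ A × d D v ≢ 0)
      split-A v∈A = Sum.map₂ (λ (_ , d≢0) → v∈A , d≢0) (isolated-or-joined (A⊆D v∈A))
      split-J : ∀ {x} → x ∈ J → x ∈ A ⊎ (x ∈ J × x ∉ D)
      split-J {x} x∈J with x ∈? D | x ∈? A
      ... | _       | yes x∈A = inj₁ x∈A
      ... | no x∉D  | no _    = inj₂ (x∈J , x∉D)
      ... | yes x∈D | no x∉A with dom-A x x∈D x∉A
      ...   | u , u∈A , x~u = ⊥-elim (ind-J x u x∈J (A⊆J u∈A) x~u)

-- Combining the bounds.

¬¬-maximum : {A : Set} (f : A → ℕ) (b : ℕ) → (∀ x → f x ≤ b) → A → ¬ ¬ (∃[ x ] ∀ y → f y ≤ f x)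
¬¬-maximum {A} f b f≤b x ¬max = climb b x (m≤n+m b (f x))
  where
  climb : ∀ m x → b ≤ f x + m → ⊥
  climb m x b≤ = ¬max (x , λ y → decidable-stable (f y ≤? f x) λ y≰x → next m y (≰⇒> y≰x) b≤)
    where
    next : ∀ m y → f x < f y → b ≤ f x + m → ⊥
    next zero    y x<y b≤ = <⇒≱ x<y (≤-trans (f≤b y) (≤-trans b≤ (≤-reflexive (+-identityʳ _))))
    next (suc m) y x<y b≤ = climb m y (≤-trans b≤ (≤-trans (≤-reflexive (+-suc (f x) m)) (+-monoˡ-≤ m x<y)))

-- A set of maximum rank is chosen only under double negation. This suffices because the goal is
-- decidable, and it avoids a search through all subsets.
independent-domination≤ : ∀ {n} (G : Graph n) {k} → 4 ≤ k → Connected G →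
  (∀ v → # (Neighbours._~?_ G v) ≡ k) → ¬ Iso G (K k) → ∀ {i} → IsIndependentDominationNumber G i → k * i + (k * i + n) ≤ k * n + i
independent-domination≤ {n} G {k} 4≤k conn reg ¬iso {i} ((S , idsS , ∣S∣≡i) , minimal) =
  decidable-stable (_ ≤? _) λ ¬goal →
    ¬¬-maximum {∃[ J ] IndependentDominating G J × # (_∈? J) ≤ i} (Rank.rank G k ∘ proj₁) n (λ _ → #≤n)
      (S , idsS , ≤-reflexive (trans (sym (∣∣≡# S)) ∣S∣≡i))
      λ ((I , ids , #I≤i) , max) → ¬goal (subst (λ j → k * j + (k * j + n) ≤ k * n + j)
        (≤-antisym #I≤i (i≤# I ids))
        (Extremal.2k*#I+n≤ G k 4≤k reg (Twins.#twins<k G reg (≤-trans (s≤s z≤n) 4≤k) conn ¬iso) I ids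
          (λ J idsJ → ≤-trans #I≤i (i≤# J idsJ))
          (λ J idsJ #J≤#I → max (J , idsJ , ≤-trans #J≤#I #I≤i))))
  where
  i≤# : ∀ J → IndependentDominating G J → i ≤ # (_∈? J)
  i≤# J idsJ = ≤-trans (minimal J idsJ) (≤-reflexive (∣∣≡# J))

-- The first bound is taken α = k - 3 times and the last 2 + α = k - 1 times: then a and b get the same
-- coefficient.
combine : ∀ α {i n a b} → let k = 3 + α in
          k * i + (k * i + n) ≤ k * n + i → n ≤ (1 + k) * a + k * b → i ≤ a + (1 + α) * b →
          i * (2 * k * k ∸ 6 * k + 2) ≤ (a + b) * (k * k * k ∸ 3 * k * k + 2)
combine α {i} {n} {a} {b} i≤n n≤ i≤ = begin
  i * (2 * k * k ∸ 6 * k + 2)        ≡⟨ cong (λ x → i * (x + 2))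
                                          (trans (cong (_∸ 6 * k) (quadratic α)) (m+n∸m≡n (6 * k) _)) ⟩
  i * (2 * k * α + 2)                ≡⟨ lhs α i ⟩
  α * ((5 + 2 * α) * i) + (2 + α) * i
    ≤⟨ +-mono-≤ (*-monoʳ-≤ α (≤-trans i≤n′ (*-monoʳ-≤ (2 + α) n≤))) (*-monoʳ-≤ (2 + α) i≤) ⟩
  α * ((2 + α) * ((1 + k) * a + k * b)) + (2 + α) * (a + (1 + α) * b)
                                     ≡⟨ rhs α a b ⟩
  (a + b) * (k * k * α + 2)          ≡⟨ cong (λ x → (a + b) * (x + 2))
                                          (trans (cong (_∸ 3 * k * k) (cubic α)) (m+n∸m≡n (3 * k * k) _)) ⟨
  (a + b) * (k * k * k ∸ 3 * k * k + 2) ∎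
  where
  open ≤-Reasoning
  k = 3 + α
  -- With k = 3 + α the truncated subtractions of the theorem are exact: 2k² - 6k = 2kα, and in
  -- `cubic` k³ - 3k² = k²α.
  quadratic : ∀ α → 2 * (3 + α) * (3 + α) ≡ 6 * (3 + α) + 2 * (3 + α) * α
  quadratic = solve-∀
  cubic : ∀ α → (3 + α) * (3 + α) * (3 + α) ≡ 3 * (3 + α) * (3 + α) + (3 + α) * (3 + α) * α
  cubic = solve-∀
  lhs : ∀ α i → i * (2 * (3 + α) * α + 2) ≡ α * ((5 + 2 * α) * i) + (2 + α) * i
  lhs = solve-∀
  rhs : ∀ α a b → α * ((2 + α) * ((4 + α) * a + (3 + α) * b)) + (2 + α) * (a + (1 + α) * b) ≡
                  (a + b) * ((3 + α) * (3 + α) * α + 2)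
  rhs = solve-∀
  splitˡ : ∀ α i n → (3 + α) * i + ((3 + α) * i + n) ≡ (i + n) + (5 + 2 * α) * i
  splitˡ = solve-∀
  splitʳ : ∀ α i n → (3 + α) * n + i ≡ (i + n) + (2 + α) * n
  splitʳ = solve-∀
  i≤n′ : (5 + 2 * α) * i ≤ (2 + α) * n
  i≤n′ = +-cancelˡ-≤ (i + n) _ _ (begin
    (i + n) + (5 + 2 * α) * i   ≡⟨ splitˡ α i n ⟨
    k * i + (k * i + n)         ≤⟨ i≤n ⟩
    k * n + i                   ≡⟨ splitʳ α i n ⟩
    (i + n) + (2 + α) * n       ∎)

theorem3 : (k n : ℕ) → 4 ≤ k → (G : Graph n) → Connected G → Regular k G →
    ¬ Iso G (K k) → (γ i : ℕ) → IsDominationNumber G γ →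
    IsIndependentDominationNumber G i →
    i * (2 * k * k ∸ 6 * k + 2) ≤ γ * (k * k * k ∸ 3 * k * k + 2)
theorem3 k n 4≤k G conn regular ¬iso γ i ((D , dom , ∣D∣≡γ) , _) isI@(_ , minimal)
  with m≤n⇒∃[o]m+o≡n 4≤k
... | j , refl = subst (λ g → i * _ ≤ g * _) (trans (sym #D≡) (trans (sym (∣∣≡# D)) ∣D∣≡γ))
  -- Since k = 4 + j, the parameter k - 3 of `combine` is 1 + j and the parameter k - 2 of
  -- `ViaDominatingSet` is 2 + j.
  (combine (1 + j) {a = # isolated?} {b = # joined?} (independent-domination≤ G 4≤k conn reg ¬iso isI) n≤ i≤)
  where
  reg : ∀ v → # (Neighbours._~?_ G v) ≡ 4 + j
  reg v = trans (sym (Neighbours.degree≡# G v)) (regular v)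
  open ViaDominatingSet G (2 + j) (s≤s (s≤s z≤n)) reg D dom
  i≤ : i ≤ # isolated? + (2 + j) * # joined?
  i≤ with independent-dominating-set
  ... | J , ids , #J≤ = ≤-trans (minimal J ids) (≤-trans (≤-reflexive (∣∣≡# J)) #J≤)
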